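{- Let $\Gamma_{\mathbb R}=\mathbf{c}^{ -1}(\mathrm{SO}_3(\mathbb{Z}[i]))\cap \mathrm{SL}_2(\mathbb{R})$ (this is the group $\mathbf c^{ -1}(\Gamma_{\mathbb Z})$), acting on $\mathbb{H}^2$ by fractional linear transformations. (a) The stabilizer of the height function is $\{\gamma\in\Gamma_{\mathbb R}: y(\gamma z)=y(z)\ \forall z\in\mathbb{H}^2\}=\pm\begin{pmatrix}1&2\mathbb{Z}\\0&1\end{pmatrix}$. (b) The interval $\mathcal{G}_{\mathbb R}:=[0,2]$ is a fundamental domain for the action on $\mathbb{R}$ induced by this stabilizer, and $\mathcal{G}_{\mathbb R}=\overline{\mathrm{Int}\,\mathcal{G}_{\mathbb R}}$. (c) Let $\mathcal F_{1,\mathbb R}=\{z\in\mathbb{H}^2: y(z)\ge y(\gamma z)\ \forall\gamma\in\Gamma_{\mathbb R}\}$ and $\mathcal F_{\mathbb R}(\mathcal G_{\mathbb R})=\{z\in\mathcal F_{1,\mathbb R}: x(z)\in\mathcal G_{\mathbb R}\}$. Then $$\mathcal F_{\mathbb R}(\mathcal G_{\mathbb R})=\{z\in\mathbb{H}^2: 0\le x(z)\le 2,\ y(z)^2+(x(z)-1)^2\ge 2\}=\mathscr{C}_{\mathbf H}(i,\,2+i,\,\infty).$$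
   Context: $\mathbb{H}^2$ is the upper half-plane, $z=x(z)+i\,y(z)$, with the hyperbolic metric. For $g\in \mathrm{SL}_2(\mathbb{C})$, $\mathbf{c}(g)$ is the matrix of $X\mapsto gXg^{ -1}$ on $\mathfrak{sl}_2(\mathbb{C})$ with respect to the basis $X_1=\begin{pmatrix}0&1\\1&0\end{pmatrix}$, $X_2=\begin{pmatrix}0&i\\-i&0\end{pmatrix}$, $Y=\begin{pmatrix}1&0\\0&-1\end{pmatrix}$, orthonormal for $\frac12\mathrm{Tr}(XY)$; $\mathbf c:\mathrm{SL}_2(\mathbb{C})\to\mathrm{SO}_3(\mathbb{C})$ is surjective with kernel $\{\pm I\}$. $\mathrm{SO}_3(\mathbb{Z}[i])$ is the subgroup of $\mathrm{SO}_3(\mathbb{C})$ of matrices with entries in $\mathbb{Z}[i]$. Fundamental domain: if a group $\Delta$ acts on a topological space $X$, $\mathcal F\subseteq X$ is a fundamental domain if $X=\Delta\mathcal F$ and for $\gamma_1\neq\gamma_2$ in $\Delta$, $\gamma_1\mathcal F\cap\gamma_2\mathcal F$ is contained in both $\gamma_1\partial\mathcal F$ and $\gamma_2\partial\mathcal F$; here groups are taken modulo $\pm I$, which acts trivially. The stabilizer of the height acts on $\mathbb{R}$ through the coordinate $x(z)$. $\mathscr{C}_{\mathbf H}(p_1,\dots,p_r)$ is the smallest geodesically convex subset of $\overline{\mathbb{H}^2}=\mathbb{H}^2\cup\mathbb{R}\cup\{\infty\}$ containing the points; the equality is understood in $\mathbb{H}^2$, i.e. up to the ideal point $\infty$. 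-}

module Defs where

open import Level using (0ℓ; _⊔_) renaming (suc to lsuc)
open import Algebra.Bundles using (RawRing; CommutativeRing)
import Algebra.Definitions.RawMonoid as RawMonoidDefs
import Algebra.Properties.Ring as RingProperties
import Algebra.Solver.Ring.NaturalCoefficients.Default as SemiringSolver
open import Data.Bool.Base using (if_then_else_)
open import Data.Empty using (⊥)
open import Data.Fin.Base using (Fin; zero; suc)
open import Data.Fin.Properties using (_≟_)
open import Data.Integer.Base using (ℤ; +_; -[1+_])
open import Data.Nat.Base as ℕ using (ℕ)
open import Data.Product.Base using (∃; ∃-syntax; _×_; _,_; proj₁; proj₂)
open import Data.Sum.Base using (_⊎_; inj₁; inj₂)
open import Data.Unit.Base using (⊤)
open import Data.Vec.Functional using (Vector; []; _∷_; transpose)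
open import Relation.Binary.Core using (Rel)
open import Relation.Binary.Structures using (IsTotalOrder)
import Relation.Binary.Construct.NonStrictToStrict as ToStrict
import Relation.Binary.Construct.Add.Supremum.NonStrict as AddSupremum
import Relation.Binary.Reasoning.Setoid as SetoidReasoning
open import Relation.Nullary.Construct.Add.Supremum using (_⁺; [_]; ⊤⁺)
open import Relation.Nullary.Decidable.Core using (does)
open import Relation.Nullary.Negation.Core using (¬_)
open import Relation.Unary using (Pred; _∈_; _⊆_; _∩_; ∁; Satisfiable)

-- The library has no real numbers, so ℝ is described by its axioms; any
-- two structures satisfying them are isomorphic.  Equality is the setoid
-- equality of the underlying commutative ring.
record CompleteOrderedField : Set₁ where
  infix 4 _≤_
  field
    commutativeRing : CommutativeRing 0ℓ 0ℓ

  open CommutativeRing commutativeRing public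

  field
    _≤_          : Rel Carrier 0ℓ
    isTotalOrder : IsTotalOrder _≈_ _≤_
    0≉1          : ¬ (0# ≈ 1#)
    inverse      : ∀ x → ¬ (x ≈ 0#) → ∃[ y ] x * y ≈ 1#
    +-monoʳ-≤    : ∀ z {x y} → x ≤ y → z + x ≤ z + y
    *-nonneg     : ∀ {x y} → 0# ≤ x → 0# ≤ y → 0# ≤ x * y

  UpperBound : Pred Carrier 0ℓ → Pred Carrier 0ℓ
  UpperBound P u = ∀ {x} → x ∈ P → x ≤ u

  field
    supremum : ∀ P → Satisfiable P → Satisfiable (UpperBound P) →
               ∃[ s ] UpperBound P s × (∀ {u} → UpperBound P u → s ≤ u)

  open IsTotalOrder isTotalOrder public
    using (antisym; total; ≤-respˡ-≈; ≤-respʳ-≈)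
    renaming (refl to ≤-refl; reflexive to ≤-reflexive; trans to ≤-trans)
  open ToStrict _≈_ _≤_ public using (_<_)
  open RingProperties ring public
    using (-‿distribˡ-*; -‿distribʳ-*; -‿involutive; -0#≈0#)

module Matrices (R : RawRing 0ℓ 0ℓ) where
  open RawRing R
  open RawMonoidDefs +-rawMonoid using (sum)

  Mat : ℕ → Set
  Mat n = Vector (Vector Carrier n) n

  infix  4 _≈ᴹ_
  infixl 7 _*ᴹ_
  infix  8 -ᴹ_

  _≈ᴹ_ : ∀ {n} → Rel (Mat n) 0ℓ
  M ≈ᴹ N = ∀ i j → M i j ≈ N i j

  _*ᴹ_ : ∀ {n} → Mat n → Mat n → Mat n
  (M *ᴹ N) i j = sum λ k → M i k * N k j

  -ᴹ_ : ∀ {n} → Mat n → Mat n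
  (-ᴹ M) i j = - M i j

  1ᴹ : ∀ {n} → Mat n
  1ᴹ i j = if does (i ≟ j) then 1# else 0#

  mat₂ : (a b c d : Carrier) → Mat 2
  mat₂ a b c d = (a ∷ b ∷ []) ∷ (c ∷ d ∷ []) ∷ []

  det₂ : Mat 2 → Carrier
  det₂ M = M zero zero * M (suc zero) (suc zero) + - (M zero (suc zero) * M (suc zero) zero)

  det₃ : Mat 3 → Carrier
  det₃ M = M 𝟘 𝟘 * (M 𝟙 𝟙 * M 𝟚 𝟚 + - (M 𝟙 𝟚 * M 𝟚 𝟙))
         + - (M 𝟘 𝟙 * (M 𝟙 𝟘 * M 𝟚 𝟚 + - (M 𝟙 𝟚 * M 𝟚 𝟘)))
         + M 𝟘 𝟚 * (M 𝟙 𝟘 * M 𝟚 𝟙 + - (M 𝟙 𝟙 * M 𝟚 𝟘))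
    where
    𝟘 𝟙 𝟚 : Fin 3
    𝟘 = zero
    𝟙 = suc zero
    𝟚 = suc (suc zero)

  record SL₂ : Set where
    constructor _,_
    field
      mat   : Mat 2
      det≈1 : det₂ mat ≈ 1#

    a b c d : Carrier
    a = mat zero zero
    b = mat zero (suc zero)
    c = mat (suc zero) zero
    d = mat (suc zero) (suc zero)

    -- The adjugate, which is the inverse because the determinant is 1.
    inv : Mat 2
    inv = mat₂ d (- b) (- c) a

  SO₃ : Pred (Mat 3) 0ℓ
  SO₃ M = (transpose M *ᴹ M ≈ᴹ 1ᴹ) × (det₃ M ≈ 1#)

  -- M is the matrix of the linear map f in the basis e: the j-th column of M
  -- holds the coordinates of f (e j).
  IsMatrixOf : (Mat 2 → Mat 2) → Vector (Mat 2) 3 → Mat 3 → Set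
  IsMatrixOf f e M = ∀ j k l → f (e j) k l ≈ sum λ i → M i j * e i k l

module Topology {X : Set} (_≈_ : Rel X 0ℓ) (Open : Pred (Pred X 0ℓ) 0ℓ) where

  Interior : ∀ {ℓ} → Pred X ℓ → Pred X (lsuc 0ℓ ⊔ ℓ)
  Interior A x = ∃[ U ] Open U × (U ⊆ A) × (x ∈ U)

  Closure : ∀ {ℓ} → Pred X ℓ → Pred X (lsuc 0ℓ ⊔ ℓ)
  Closure A x = ∀ U → Open U → x ∈ U → Satisfiable (U ∩ A)

  ∂ : ∀ {ℓ} → Pred X ℓ → Pred X (lsuc 0ℓ ⊔ ℓ)
  ∂ A = Closure A ∩ ∁ (Interior A)

  Image : ∀ {ℓ} → (X → X) → Pred X ℓ → Pred X ℓ
  Image f A x = ∃[ a ] (a ∈ A) × (x ≈ f a)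

  -- _∼_ is the equality of the acting group Δ.
  IsFundamentalDomain : {Δ : Set} (_∼_ : Rel Δ 0ℓ) (_·_ : Δ → X → X) → Pred X 0ℓ → Set₁
  IsFundamentalDomain _∼_ _·_ F =
    (∀ x → ∃[ γ ] x ∈ Image (γ ·_) F) ×
    (∀ γ₁ γ₂ → ¬ (γ₁ ∼ γ₂) →
       (Image (γ₁ ·_) F ∩ Image (γ₂ ·_) F) ⊆ (Image (γ₁ ·_) (∂ F) ∩ Image (γ₂ ·_) (∂ F)))

module UpperHalfPlane (R : CompleteOrderedField) where
  open CompleteOrderedField R

  ℝ : Set
  ℝ = Carrier

  2# : ℝ
  2# = 1# + 1#

  open RawMonoidDefs +-rawMonoid using () renaming (_×_ to _·ℕ_)

  fromℤ : ℤ → ℝ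
  fromℤ (+ n)    = n ·ℕ 1#
  fromℤ -[1+ n ] = - (ℕ.suc n ·ℕ 1#)

  OpenInℝ : Pred (Pred ℝ 0ℓ) 0ℓ
  OpenInℝ U = ∀ {x} → x ∈ U → ∃[ ε ] (0# < ε) × (∀ y → x - ε < y → y < x + ε → y ∈ U)

  open Topology _≈_ OpenInℝ public

  x²≥0 : ∀ x → 0# ≤ x * x
  x²≥0 x with total 0# x
  ... | inj₁ 0≤x = *-nonneg 0≤x 0≤x
  ... | inj₂ x≤0 = ≤-respʳ-≈ -x*-x≈x*x (*-nonneg 0≤-x 0≤-x)
    where
    0≤-x : 0# ≤ - x
    0≤-x = ≤-respˡ-≈ (-‿inverseˡ x) (≤-respʳ-≈ (+-identityʳ (- x)) (+-monoʳ-≤ (- x) x≤0))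
    -x*-x≈x*x : - x * - x ≈ x * x
    -x*-x≈x*x = trans (sym (-‿distribˡ-* x (- x)))
               (trans (-‿cong (sym (-‿distribʳ-* x x))) (-‿involutive (x * x)))

  0<1 : 0# < 1#
  0<1 = ≤-respʳ-≈ (*-identityˡ 1#) (x²≥0 1#) , 0≉1

  x²≉0 : ∀ {x} → ¬ (x ≈ 0#) → ¬ (x * x ≈ 0#)
  x²≉0 {x} x≉0 x²≈0 with inverse x x≉0
  ... | y , xy≈1 = x≉0 (begin
    x            ≈⟨ *-identityʳ x ⟨
    x * 1#       ≈⟨ *-congˡ xy≈1 ⟨
    x * (x * y)  ≈⟨ *-assoc x x y ⟨
    x * x * y    ≈⟨ *-congʳ x²≈0 ⟩
    0# * y       ≈⟨ zeroˡ y ⟩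
    0#           ∎)
    where open SetoidReasoning setoid

  ≤-+ʳ : ∀ x {y} → 0# ≤ y → x ≤ x + y
  ≤-+ʳ x 0≤y = ≤-respˡ-≈ (+-identityʳ x) (+-monoʳ-≤ x 0≤y)

  x²+y²≉0ˡ : ∀ {x} y → ¬ (x ≈ 0#) → ¬ (x * x + y * y ≈ 0#)
  x²+y²≉0ˡ {x} y x≉0 eq =
    x²≉0 x≉0 (antisym (≤-respʳ-≈ eq (≤-+ʳ (x * x) (x²≥0 y))) (x²≥0 x))

  inverse-nonneg : ∀ {x y} → 0# ≤ x → x * y ≈ 1# → 0# ≤ y
  inverse-nonneg {x} {y} 0≤x xy≈1 = ≤-respʳ-≈ eq (*-nonneg 0≤x (x²≥0 y))
    where
    eq : x * (y * y) ≈ y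
    eq = trans (sym (*-assoc x y y)) (trans (*-congʳ xy≈1) (*-identityˡ y))

  [x+y]-y≈x : ∀ x y → (x + y) - y ≈ x
  [x+y]-y≈x x y = trans (+-assoc x y (- y)) (trans (+-congˡ (-‿inverseʳ y)) (+-identityʳ x))

  infix 5 _+i_ _+i_⟨_⟩
  record ℂ : Set where
    constructor _+i_
    field
      re im : ℝ
  open ℂ public

  ℂ-rawRing : RawRing 0ℓ 0ℓ
  ℂ-rawRing = record
    { Carrier = ℂ
    ; _≈_ = λ z w → (re z ≈ re w) × (im z ≈ im w)
    ; _+_ = λ z w → (re z + re w) +i (im z + im w)
    ; _*_ = λ z w → (re z * re w - im z * im w) +i (re z * im w + im z * re w)
    ; -_  = λ z → (- re z) +i (- im z)
    ; 0#  = 0# +i 0#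
    ; 1#  = 1# +i 0#
    }

  module ℂᵣ = RawRing ℂ-rawRing

  infix 8 _‾
  _‾ : ℂ → ℂ
  z ‾ = re z +i - im z

  ∥_∥² : ℂ → ℝ
  ∥ z ∥² = re z * re z + im z * im z

  _÷_[_] : (z w : ℂ) → ¬ (∥ w ∥² ≈ 0#) → ℂ
  z ÷ w [ w≉0 ] = z ℂᵣ.* w ‾ ℂᵣ.* (proj₁ (inverse ∥ w ∥² w≉0) +i 0#)

  ℤ[i] : Pred ℂ 0ℓ
  ℤ[i] z = ∃[ m ] ∃[ n ] z ℂᵣ.≈ (fromℤ m +i fromℤ n)

  module Matℝ = Matrices rawRing
  module Matℂ = Matrices ℂ-rawRing

  open Matℝ public using () renaming (SL₂ to SL₂ℝ)
  open Matℂ public using () renaming (SL₂ to SL₂ℂ; SO₃ to SO₃ℂ)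

  toℂ : ℝ → ℂ
  toℂ x = x +i 0#

  toℂ-det : ∀ a b c d → a * d + - (b * c) ≈ 1# →
            (toℂ a ℂᵣ.* toℂ d ℂᵣ.+ ℂᵣ.- (toℂ b ℂᵣ.* toℂ c)) ℂᵣ.≈ ℂᵣ.1#
  toℂ-det a b c d eq =
    trans (+-cong (real a d) (-‿cong (real b c))) eq ,
    trans (+-cong (imag a d) (trans (-‿cong (imag b c)) -0#≈0#)) (+-identityʳ 0#)
    where
    real : ∀ x y → x * y - 0# * 0# ≈ x * y
    real x y = trans (+-congˡ (trans (-‿cong (zeroˡ 0#)) -0#≈0#)) (+-identityʳ (x * y))
    imag : ∀ x y → x * 0# + 0# * y ≈ 0#
    imag x y = trans (+-cong (zeroʳ x) (zeroˡ y)) (+-identityʳ 0#)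

  SL₂ℝ→SL₂ℂ : SL₂ℝ → SL₂ℂ
  SL₂ℝ→SL₂ℂ γ = record
    { mat   = λ i j → mat i j +i 0#
    ; det≈1 = toℂ-det a b c d det≈1
    }
    where open SL₂ℝ γ

  X₁ X₂ Y : Matℂ.Mat 2
  X₁ = Matℂ.mat₂ ℂᵣ.0# ℂᵣ.1# ℂᵣ.1# ℂᵣ.0#
  X₂ = Matℂ.mat₂ ℂᵣ.0# (0# +i 1#) (0# +i - 1#) ℂᵣ.0#
  Y  = Matℂ.mat₂ ℂᵣ.1# ℂᵣ.0# ℂᵣ.0# (ℂᵣ.- ℂᵣ.1#)

  Ad : SL₂ℂ → Matℂ.Mat 2 → Matℂ.Mat 2
  Ad g X = SL₂ℂ.mat g Matℂ.*ᴹ X Matℂ.*ᴹ SL₂ℂ.inv g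

  -- The graph of 𝐜 : SL₂(ℂ) → SO₃(ℂ).
  infix 4 𝐜_↦_
  𝐜_↦_ : SL₂ℂ → Matℂ.Mat 3 → Set
  𝐜 g ↦ M = Matℂ.IsMatrixOf (Ad g) (X₁ ∷ X₂ ∷ Y ∷ []) M

  𝐜⁻¹ : Pred (Matℂ.Mat 3) 0ℓ → Pred SL₂ℂ 0ℓ
  𝐜⁻¹ P g = ∃[ M ] (𝐜 g ↦ M) × (M ∈ P)

  SO₃ℤ[i] : Pred (Matℂ.Mat 3) 0ℓ
  SO₃ℤ[i] M = (M ∈ SO₃ℂ) × (∀ i j → M i j ∈ ℤ[i])

  Γℝ : Pred SL₂ℝ 0ℓ
  Γℝ γ = SL₂ℝ→SL₂ℂ γ ∈ 𝐜⁻¹ SO₃ℤ[i]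

  record ℍ² : Set where
    constructor _+i_⟨_⟩
    field
      x y : ℝ
      y>0 : 0# < y
  open ℍ² public

  numerator denominator : SL₂ℝ → ℍ² → ℂ
  numerator   γ z = (a * x z + b) +i (a * y z) where open SL₂ℝ γ
  denominator γ z = (c * x z + d) +i (c * y z) where open SL₂ℝ γ

  im-numerator*denominator‾ : ∀ γ z → im (numerator γ z ℂᵣ.* denominator γ z ‾) ≈ y z
  im-numerator*denominator‾ γ z = begin
    p * - s + q * r                          ≈⟨ +-congʳ (-‿distribʳ-* p s) ⟨
    - (p * s) + q * r                        ≈⟨ +-comm _ _ ⟩
    q * r - p * s                            ≈⟨ +-congʳ ([x+y]-y≈x _ (b * c * y z)) ⟨
    q * r + b * c * y z - b * c * y z - p * s
      ≈⟨ +-congʳ (+-congʳ (solve 6 (λ A B C D u v →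
           A :* v :* (C :* u :+ D) :+ B :* C :* v := A :* D :* v :+ (A :* u :+ B) :* (C :* v))
           refl a b c d (x z) (y z))) ⟩
    a * d * y z + p * s - b * c * y z - p * s
      ≈⟨ +-congʳ (trans (+-assoc _ _ _) (trans (+-congˡ (+-comm _ _)) (sym (+-assoc _ _ _)))) ⟩
    a * d * y z - b * c * y z + p * s - p * s  ≈⟨ [x+y]-y≈x _ _ ⟩
    a * d * y z - b * c * y z                ≈⟨ +-congˡ (-‿distribˡ-* (b * c) (y z)) ⟩
    a * d * y z + - (b * c) * y z            ≈⟨ distribʳ (y z) (a * d) (- (b * c)) ⟨
    (a * d + - (b * c)) * y z                ≈⟨ *-congʳ det≈1 ⟩
    1# * y z                                 ≈⟨ *-identityˡ (y z) ⟩
    y z                                      ∎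
    where
    open SL₂ℝ γ
    open SetoidReasoning setoid
    open SemiringSolver commutativeSemiring using (solve; _:=_; _:+_; _:*_)
    p q r s : ℝ
    p = re (numerator γ z)
    q = im (numerator γ z)
    r = re (denominator γ z)
    s = im (denominator γ z)

  denominator≉0 : ∀ γ z → ¬ (∥ denominator γ z ∥² ≈ 0#)
  denominator≉0 γ z N≈0 = r≉0→⊥ λ r≈0 → s≉0→⊥ λ s≈0 → proj₂ (y>0 z) (sym (begin
    y z              ≈⟨ im-numerator*denominator‾ γ z ⟨
    p * - s + q * r  ≈⟨ +-cong (*-congˡ (trans (-‿cong s≈0) -0#≈0#)) (*-congˡ r≈0) ⟩
    p * 0# + q * 0#  ≈⟨ +-cong (zeroʳ p) (zeroʳ q) ⟩
    0# + 0#          ≈⟨ +-identityʳ 0# ⟩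
    0#               ∎))
    where
    open SetoidReasoning setoid
    p q r s : ℝ
    p = re (numerator γ z)
    q = im (numerator γ z)
    r = re (denominator γ z)
    s = im (denominator γ z)
    r≉0→⊥ : ¬ ¬ (r ≈ 0#)
    r≉0→⊥ r≉0 = x²+y²≉0ˡ s r≉0 N≈0
    s≉0→⊥ : ¬ ¬ (s ≈ 0#)
    s≉0→⊥ s≉0 = x²+y²≉0ˡ r s≉0 (trans (+-comm _ _) N≈0)

  möbius : SL₂ℝ → ℍ² → ℂ
  möbius γ z = numerator γ z ÷ denominator γ z [ denominator≉0 γ z ]

  möbius-im>0 : ∀ γ z → 0# < im (möbius γ z)
  möbius-im>0 γ z = ≤-respʳ-≈ (sym im≈) (*-nonneg (proj₁ (y>0 z)) 0≤N⁻¹) , λ 0≈im →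
    proj₂ (y>0 z) (begin
      0#                ≈⟨ zeroˡ N ⟨
      0# * N            ≈⟨ *-congʳ (trans 0≈im im≈) ⟩
      y z * N⁻¹ * N     ≈⟨ *-assoc (y z) N⁻¹ N ⟩
      y z * (N⁻¹ * N)   ≈⟨ *-congˡ (trans (*-comm N⁻¹ N) N*N⁻¹≈1) ⟩
      y z * 1#          ≈⟨ *-identityʳ (y z) ⟩
      y z               ∎)
    where
    open SetoidReasoning setoid
    N N⁻¹ : ℝ
    N   = ∥ denominator γ z ∥²
    N⁻¹ = proj₁ (inverse N (denominator≉0 γ z))
    N*N⁻¹≈1 : N * N⁻¹ ≈ 1#
    N*N⁻¹≈1 = proj₂ (inverse N (denominator≉0 γ z))
    0≤N⁻¹ : 0# ≤ N⁻¹
    0≤N⁻¹ = inverse-nonneg (≤-trans (x²≥0 _) (≤-+ʳ _ (x²≥0 _))) N*N⁻¹≈1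
    im≈ : im (möbius γ z) ≈ y z * N⁻¹
    im≈ = trans (+-congʳ (zeroʳ _))
         (trans (+-identityˡ _) (*-congʳ (im-numerator*denominator‾ γ z)))

  infixr 7 _•_
  _•_ : SL₂ℝ → ℍ² → ℍ²
  γ • z = re (möbius γ z) +i im (möbius γ z) ⟨ möbius-im>0 γ z ⟩

  HeightStabilizer : Pred SL₂ℝ 0ℓ
  HeightStabilizer γ = (γ ∈ Γℝ) × (∀ z → y (γ • z) ≈ y z)

  ±Unipotent2ℤ : Pred SL₂ℝ 0ℓ
  ±Unipotent2ℤ γ = ∃[ n ] ((mat Matℝ.≈ᴹ U n) ⊎ (mat Matℝ.≈ᴹ Matℝ.-ᴹ U n))
    where
    open SL₂ℝ γ
    U : ℤ → Matℝ.Mat 2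
    U n = Matℝ.mat₂ 1# (2# * fromℤ n) 0# 1#

  Δ : Set
  Δ = ∃ HeightStabilizer

  -- Equality in the stabilizer modulo ± I.
  infix 4 _≈±_
  _≈±_ : Rel Δ 0ℓ
  (γ , _) ≈± (δ , _) =
    (SL₂ℝ.mat γ Matℝ.≈ᴹ SL₂ℝ.mat δ) ⊎ (SL₂ℝ.mat γ Matℝ.≈ᴹ Matℝ.-ᴹ SL₂ℝ.mat δ)

  -- t is moved as the x-coordinate of the point t + i; for an element of the
  -- stabilizer any other point above t gives the same result, which is what
  -- ⋆-IsInducedByx asserts.
  infixr 7 _⋆_
  _⋆_ : Δ → ℝ → ℝ
  (γ , _) ⋆ t = x (γ • (t +i 1# ⟨ 0<1 ⟩))

  ⋆-IsInducedByx : Set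
  ⋆-IsInducedByx = ∀ σ z → x (proj₁ σ • z) ≈ σ ⋆ x z

  𝒢ℝ : Pred ℝ 0ℓ
  𝒢ℝ t = (0# ≤ t) × (t ≤ 2#)

  ℱ₁ℝ : Pred ℍ² 0ℓ
  ℱ₁ℝ z = ∀ γ → γ ∈ Γℝ → y (γ • z) ≤ y z

  ℱℝ : Pred ℝ 0ℓ → Pred ℍ² 0ℓ
  ℱℝ 𝒢 z = (z ∈ ℱ₁ℝ) × (x z ∈ 𝒢)

  data ℍ̄² : Set where
    inner : ℍ² → ℍ̄²
    real  : ℝ → ℍ̄²
    ∞     : ℍ̄²

  -- Complete geodesics: vertical half-lines and semicircles centred on the
  -- real axis, given by their centre and radius.
  data Geodesic : Set where
    vertical   : ℝ → Geodesic
    semicircle : (m r : ℝ) → 0# < r → Geodesic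

  -- Geodesics contain their two ideal endpoints.
  infix 4 _on_
  _on_ : ℍ̄² → Geodesic → Set
  inner z on vertical m         = x z ≈ m
  real t  on vertical m         = t ≈ m
  ∞       on vertical m         = ⊤
  inner z on semicircle m r _   = (x z - m) * (x z - m) + y z * y z ≈ r * r
  real t  on semicircle m r _   = (t - m) * (t - m) ≈ r * r
  ∞       on semicircle m r _   = ⊥

  open AddSupremum _≤_ public using (_≤⁺_)

  -- A coordinate, monotone along the geodesic: the height on a vertical line,
  -- the abscissa on a semicircle (where the value at ∞ is irrelevant).
  position : Geodesic → ℍ̄² → ℝ ⁺
  position (vertical _)       (inner z) = [ y z ]
  position (vertical _)       (real _)  = [ 0# ]
  position (semicircle _ _ _) (inner z) = [ x z ]
  position (semicircle _ _ _) (real t)  = [ t ]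
  position _                  ∞         = ⊤⁺

  Segment : ℍ̄² → ℍ̄² → Pred ℍ̄² 0ℓ
  Segment p q w = ∃[ L ] (p on L) × (q on L) × (w on L) ×
    ((position L p ≤⁺ position L w × position L w ≤⁺ position L q) ⊎
     (position L q ≤⁺ position L w × position L w ≤⁺ position L p))

  Convex : Pred ℍ̄² 0ℓ → Set
  Convex S = ∀ {p q} → p ∈ S → q ∈ S → Segment p q ⊆ S

  -- The smallest convex set containing the points, as an intersection.
  𝒞ᴴ : ∀ {r} → Vector ℍ̄² r → Pred ℍ̄² (lsuc 0ℓ)
  𝒞ᴴ p w = ∀ S → Convex S → (∀ k → p k ∈ S) → w ∈ S

  𝐢 2+𝐢 : ℍ²
  𝐢   = 0# +i 1# ⟨ 0<1 ⟩
  2+𝐢 = 2# +i 1# ⟨ 0<1 ⟩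

  infixl 6 _∪∞
  _∪∞ : Pred ℍ² 0ℓ → Pred ℍ̄² 0ℓ
  (S ∪∞) (inner z) = z ∈ S
  (S ∪∞) (real _)  = ⊥
  (S ∪∞) ∞         = ⊤

  CircleRegion : Pred ℍ² 0ℓ
  CircleRegion z = (0# ≤ x z) × (x z ≤ 2#) × (2# ≤ y z * y z + (x z - 1#) * (x z - 1#))

{-# OPTIONS --safe #-}

-- Writing out the adjoint action of a real g = (a b; c d) shows that γ ∈ Γℝ
-- forces c² + d², d² − c², 2cd, bd − ac and (a² + b² + c² + d²)/2 to be integers.
--
-- Since y(γz) |cz + d|² = y(z), preserving the height at i and 2i gives c = 0 and
-- d = ± 1; then b = ± n with n² even, so γ is ± a translation by an even integer.
--
-- A point z of ℱ₁ satisfies |cz + d|² ≥ 1 for the element of Γℝ with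
-- c = − d = 1/√2, which is the condition |z − 1|² ≥ 2.  Conversely, with x = x(z),
--   2(|cz + d|² − 1) = 2c²(|z − 1|² − 2) + (2 − x)(N₀ − 1) + x(N₂ − 1),
-- where N₀ = c² + d² and N₂ = c² + (2c + d)² are positive integers.
--
-- On a semicircle centred on the real axis |z − 1|² is an affine function of x,
-- so the region |z − 1|² ≥ 2 above [0,2] is geodesically convex; and each of its
-- points lies on the vertical ray from a point of the arc from i to 2 + i.
module Submission where

open import Defs
open import Level using (0ℓ)
open import Algebra.Bundles using (CommutativeRing; RawRing)
import Algebra.Definitions.RawMonoid as RawMonoidDefs
import Algebra.Properties.Ring as RingProperties
import Algebra.Properties.Semiring.Mult.TCOptimised as Multiplication
import Algebra.Solver.Ring as RingSolver
open import Algebra.Solver.Ring.AlmostCommutativeRing using (fromCommutativeRing; _-Raw-AlmostCommutative⟶_)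
open import Axiom.ExcludedMiddle using (ExcludedMiddle)
open import Data.Empty using (⊥-elim)
open import Data.Fin.Base using (Fin)
open import Data.Fin.Patterns using (0F; 1F; 2F; 3F; 4F; 5F; 6F; 7F; 8F; 9F)
open import Data.Integer.Base as ℤ using (ℤ; +_; -[1+_])
import Data.Integer.Divisibility.Signed as ℤ
import Data.Integer.Properties as ℤ
open import Data.Maybe.Base as Maybe using (Maybe)
open import Data.Nat.Base as ℕ using (ℕ; zero; suc)
open import Data.Nat.Divisibility using (_∣_; divides)
open import Data.Nat.Primality using (euclidsLemma; prime[2])
import Data.Nat.Properties as ℕ
open import Data.Product.Base using (∃-syntax; _×_; _,_; proj₁; proj₂)
open import Data.Sum.Base using (_⊎_; inj₁; inj₂; [_,_]′)
open import Data.Unit.Base using (tt)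
open import Data.Vec.Base using (Vec; lookup) renaming ([] to []ᵛ; _∷_ to _∷ᵛ_)
open import Data.Vec.Functional using (Vector; []; _∷_; transpose)
open import Function.Base using (id)
open import Relation.Binary.Construct.Add.Supremum.NonStrict using ([_]; _≤⊤⁺)
open import Relation.Binary.PropositionalEquality.Core as ≡ using (_≡_)
import Relation.Binary.Reasoning.Setoid as SetoidReasoning
open import Relation.Nullary.Decidable.Core using (yes; no; dec⇒maybe)
open import Relation.Nullary.Negation.Core using (¬_)
open import Relation.Unary using (Pred; _∈_; _⊆_; _∩_; _≐_; Satisfiable)

-- A ring solver with integer coefficients over any commutative ring.

module IntegerSolver (R : CommutativeRing 0ℓ 0ℓ) where
  open CommutativeRing R
  open RingProperties ring using (-0#≈0#; -‿involutive; -‿+-comm; -‿distribˡ-*; -‿distribʳ-*)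
  open Multiplication semiring renaming (_×_ to _·_)
  open SetoidReasoning setoid

  -- The optimised multiple makes `con (+ 1)` and `con (+ 2)` evaluate definitionally to `1#` and
  -- `1# + 1#`, so solved equations match the goals without conversion.
  ⟦_⟧ℤ : ℤ → Carrier
  ⟦ + n      ⟧ℤ = n · 1#
  ⟦ -[1+ n ] ⟧ℤ = - (suc n · 1#)

  private
    cancel-1# : ∀ a b → a - b ≈ (1# + a) - (1# + b)
    cancel-1# a b = sym (begin
      (1# + a) - (1# + b)      ≈⟨ +-cong (+-comm 1# a) (-‿cong (+-comm 1# b)) ⟩
      (a + 1#) - (b + 1#)      ≈⟨ +-congˡ (-‿+-comm b 1#) ⟨
      (a + 1#) + (- b - 1#)    ≈⟨ +-congˡ (+-comm (- b) (- 1#)) ⟩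
      (a + 1#) + (- 1# - b)    ≈⟨ +-assoc a 1# _ ⟩
      a + (1# + (- 1# - b))    ≈⟨ +-congˡ (+-assoc 1# (- 1#) (- b)) ⟨
      a + ((1# - 1#) - b)      ≈⟨ +-congˡ (+-congʳ (-‿inverseʳ 1#)) ⟩
      a + (0# - b)             ≈⟨ +-congˡ (+-identityˡ (- b)) ⟩
      a - b                    ∎)

  -- Induction strips one successor from both arguments; `cancel-1#` is the matching step in the
  -- ring.
  ⊖-homo : ∀ m n → ⟦ m ℤ.⊖ n ⟧ℤ ≈ m · 1# - n · 1#
  ⊖-homo zero    zero    = sym (-‿inverseʳ 0#)
  ⊖-homo zero    (suc n) = sym (+-identityˡ _)
  ⊖-homo (suc m) zero    = sym (trans (+-congˡ -0#≈0#) (+-identityʳ _))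
  ⊖-homo (suc m) (suc n) = begin
    ⟦ suc m ℤ.⊖ suc n ⟧ℤ            ≡⟨ ≡.cong ⟦_⟧ℤ (ℤ.[1+m]⊖[1+n]≡m⊖n m n) ⟩
    ⟦ m ℤ.⊖ n ⟧ℤ                    ≈⟨ ⊖-homo m n ⟩
    m · 1# - n · 1#                 ≈⟨ cancel-1# _ _ ⟩
    (1# + m · 1#) - (1# + n · 1#)   ≈⟨ +-cong (1+× m 1#) (-‿cong (1+× n 1#)) ⟨
    suc m · 1# - suc n · 1#         ∎

  -‿homo : ∀ i → ⟦ ℤ.- i ⟧ℤ ≈ - ⟦ i ⟧ℤ
  -‿homo (+ zero)  = sym -0#≈0#
  -‿homo (+ suc n) = refl
  -‿homo -[1+ n ]  = sym (-‿involutive _)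

  +-homo : ∀ i j → ⟦ i ℤ.+ j ⟧ℤ ≈ ⟦ i ⟧ℤ + ⟦ j ⟧ℤ
  +-homo (+ m)    (+ n)    = ×-homo-+ 1# m n
  +-homo (+ m)    -[1+ n ] = ⊖-homo m (suc n)
  +-homo -[1+ m ] (+ n)    = trans (⊖-homo n (suc m)) (+-comm _ _)
  +-homo -[1+ m ] -[1+ n ] = begin
    - (suc (suc (m ℕ.+ n)) · 1#)      ≡⟨ ≡.cong (λ k → - (k · 1#)) (≡.cong suc (ℕ.+-suc m n)) ⟨
    - ((suc m ℕ.+ suc n) · 1#)        ≈⟨ -‿cong (×-homo-+ 1# (suc m) (suc n)) ⟩
    - (suc m · 1# + suc n · 1#)       ≈⟨ -‿+-comm _ _ ⟨
    - (suc m · 1#) - suc n · 1#       ∎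

  private
    +*-homo : ∀ m j → ⟦ + m ℤ.* j ⟧ℤ ≈ m · 1# * ⟦ j ⟧ℤ
    +*-homo m (+ n) = begin
      ⟦ + m ℤ.* + n ⟧ℤ   ≡⟨ ≡.cong ⟦_⟧ℤ (ℤ.pos-* m n) ⟨
      (m ℕ.* n) · 1#     ≈⟨ ×1-homo-* m n ⟩
      m · 1# * n · 1#    ∎
    +*-homo m -[1+ n ] = begin
      ⟦ + m ℤ.* -[1+ n ] ⟧ℤ        ≡⟨ ≡.cong ⟦_⟧ℤ (ℤ.neg-distribʳ-* (+ m) (+ suc n)) ⟨
      ⟦ ℤ.- (+ m ℤ.* + suc n) ⟧ℤ   ≈⟨ -‿homo (+ m ℤ.* + suc n) ⟩
      - ⟦ + m ℤ.* + suc n ⟧ℤ       ≈⟨ -‿cong (+*-homo m (+ suc n)) ⟩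
      - (m · 1# * suc n · 1#)      ≈⟨ -‿distribʳ-* _ _ ⟩
      m · 1# * - (suc n · 1#)      ∎

  *-homo : ∀ i j → ⟦ i ℤ.* j ⟧ℤ ≈ ⟦ i ⟧ℤ * ⟦ j ⟧ℤ
  *-homo (+ m)    j = +*-homo m j
  *-homo -[1+ m ] j = begin
    ⟦ -[1+ m ] ℤ.* j ⟧ℤ         ≡⟨ ≡.cong ⟦_⟧ℤ (ℤ.neg-distribˡ-* (+ suc m) j) ⟨
    ⟦ ℤ.- (+ suc m ℤ.* j) ⟧ℤ    ≈⟨ -‿homo (+ suc m ℤ.* j) ⟩
    - ⟦ + suc m ℤ.* j ⟧ℤ        ≈⟨ -‿cong (+*-homo (suc m) j) ⟩
    - (suc m · 1# * ⟦ j ⟧ℤ)     ≈⟨ -‿distribˡ-* _ _ ⟩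
    - (suc m · 1#) * ⟦ j ⟧ℤ     ∎

  homomorphism : ℤ.+-*-rawRing -Raw-AlmostCommutative⟶ fromCommutativeRing R
  homomorphism = record
    { ⟦_⟧    = ⟦_⟧ℤ
    ; +-homo = +-homo
    ; *-homo = *-homo
    ; -‿homo = -‿homo
    ; 0-homo = refl
    ; 1-homo = refl
    }

  -- Coefficients are compared in ℤ, where equality is decidable; equal integers have equal images,
  -- and a negative answer claims nothing.
  ⟦⟧ℤ-weaklyDecidable : ∀ i j → Maybe (⟦ i ⟧ℤ ≈ ⟦ j ⟧ℤ)
  ⟦⟧ℤ-weaklyDecidable i j = Maybe.map (λ i≡j → reflexive (≡.cong ⟦_⟧ℤ i≡j)) (dec⇒maybe (i ℤ.≟ j))

  open RingSolver _ _ homomorphism ⟦⟧ℤ-weaklyDecidable public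
    using (Polynomial; op; [+]; [*]; con; var; _:^_; :-_; _:+_; _:*_; _:-_; ⟦_⟧; ⟦_⟧↓; prove; solve; _:=_)

-- Arithmetic and order in a complete ordered field.

module OrderedField (em : ExcludedMiddle 0ℓ) (R : CompleteOrderedField) where
  open CompleteOrderedField R
  open UpperHalfPlane R using (2#; fromℤ; x²≥0; 0<1; inverse-nonneg; x²+y²≉0ˡ; ≤-+ʳ)
  open IntegerSolver commutativeRing public
  open Multiplication semiring using (×ᵤ≈×)
  open SetoidReasoning setoid

  x-y≈0⇒x≈y : ∀ {x y} → x - y ≈ 0# → x ≈ y
  x-y≈0⇒x≈y {x} {y} x-y≈0 = begin
    x            ≈⟨ solve 2 (λ x y → x := x :- y :+ y) refl x y ⟩
    x - y + y    ≈⟨ +-congʳ x-y≈0 ⟩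
    0# + y       ≈⟨ +-identityˡ y ⟩
    y            ∎

  x≈y⇒x-y≈0 : ∀ {x y} → x ≈ y → x - y ≈ 0#
  x≈y⇒x-y≈0 {x} {y} x≈y = trans (+-congʳ x≈y) (-‿inverseʳ y)

  -- This reduces the use of an equation `u ≈ v` to a ring identity: the solver exhibits the
  -- difference of the two sides of the goal as a multiple of `u - v`.
  ≈-combine : ∀ {l r u v} → u ≈ v → ∀ k → l - r ≈ k * (u - v) → l ≈ r
  ≈-combine u≈v k eq = x-y≈0⇒x≈y (trans eq (trans (*-congˡ (x≈y⇒x-y≈0 u≈v)) (zeroʳ k)))

  0≤y-x⇒x≤y : ∀ {x y} → 0# ≤ y - x → x ≤ y
  0≤y-x⇒x≤y {x} {y} 0≤y-x =
    ≤-respˡ-≈ (+-identityʳ x) (≤-respʳ-≈ (solve 2 (λ x y → x :+ (y :- x) := y) refl x y) (+-monoʳ-≤ x 0≤y-x))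

  x≤y⇒0≤y-x : ∀ {x y} → x ≤ y → 0# ≤ y - x
  x≤y⇒0≤y-x {x} {y} x≤y =
    ≤-respˡ-≈ (-‿inverseˡ x) (≤-respʳ-≈ (+-comm (- x) y) (+-monoʳ-≤ (- x) x≤y))

  -- The counterpart of `≈-combine` for the order: the solver matches an expression already known to
  -- be nonnegative with the gap `y - x`.
  ≤-combine : ∀ {x y d} → 0# ≤ d → d ≈ y - x → x ≤ y
  ≤-combine 0≤d d≈ = 0≤y-x⇒x≤y (≤-respʳ-≈ d≈ 0≤d)

  +-nonneg : ∀ {x y} → 0# ≤ x → 0# ≤ y → 0# ≤ x + y
  +-nonneg {x} 0≤x 0≤y = ≤-trans 0≤x (≤-+ʳ x 0≤y)

  <⇒≱ : ∀ {x y} → x < y → ¬ (y ≤ x)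
  <⇒≱ (x≤y , x≉y) y≤x = x≉y (antisym x≤y y≤x)

  ≰⇒≥ : ∀ {x y} → ¬ (x ≤ y) → y ≤ x
  ≰⇒≥ {x} {y} x≰y with total x y
  ... | inj₁ x≤y = ⊥-elim (x≰y x≤y)
  ... | inj₂ y≤x = y≤x

  ≰⇒> : ∀ {x y} → ¬ (x ≤ y) → y < x
  ≰⇒> x≰y = ≰⇒≥ x≰y , λ y≈x → x≰y (≤-reflexive (sym y≈x))

  ≮⇒≥ : ∀ {x y} → ¬ (x < y) → y ≤ x
  ≮⇒≥ {x} {y} x≮y with em {y ≤ x}
  ... | yes y≤x = y≤x
  ... | no  y≰x = ⊥-elim (x≮y (≰⇒> y≰x))

  <-combine : ∀ {x y d} → 0# < d → d ≈ y - x → x < y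
  <-combine (0≤d , 0≉d) d≈ = ≤-combine 0≤d d≈ , λ x≈y →
    0≉d (sym (trans d≈ (x≈y⇒x-y≈0 (sym x≈y))))

  x<y⇒0<y-x : ∀ {x y} → x < y → 0# < y - x
  x<y⇒0<y-x (x≤y , x≉y) = x≤y⇒0≤y-x x≤y , λ 0≈y-x → x≉y (sym (x-y≈0⇒x≈y (sym 0≈y-x)))

  <-≤-trans : ∀ {x y z} → x < y → y ≤ z → x < z
  <-≤-trans x<y@(x≤y , _) y≤z = ≤-trans x≤y y≤z , λ x≈z → <⇒≱ x<y (≤-trans y≤z (≤-reflexive (sym x≈z)))

  0<⇒≉0 : ∀ {x} → 0# < x → ¬ (x ≈ 0#)
  0<⇒≉0 (_ , 0≉x) x≈0 = 0≉x (sym x≈0)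

  x*y≈0⇒x≈0∨y≈0 : ∀ {x y} → x * y ≈ 0# → x ≈ 0# ⊎ y ≈ 0#
  x*y≈0⇒x≈0∨y≈0 {x} {y} xy≈0 with em {x ≈ 0#}
  ... | yes x≈0 = inj₁ x≈0
  ... | no  x≉0 = let x⁻¹ , xx⁻¹≈1 = inverse x x≉0 in inj₂ (begin
    y                ≈⟨ *-identityʳ y ⟨
    y * 1#           ≈⟨ *-congˡ xx⁻¹≈1 ⟨
    y * (x * x⁻¹)    ≈⟨ solve 3 (λ x y i → y :* (x :* i) := i :* (x :* y)) refl x y x⁻¹ ⟩
    x⁻¹ * (x * y)    ≈⟨ *-congˡ xy≈0 ⟩
    x⁻¹ * 0#         ≈⟨ zeroʳ x⁻¹ ⟩
    0#               ∎)

  x*x≈0⇒x≈0 : ∀ {x} → x * x ≈ 0# → x ≈ 0#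
  x*x≈0⇒x≈0 x²≈0 with x*y≈0⇒x≈0∨y≈0 x²≈0
  ... | inj₁ x≈0 = x≈0
  ... | inj₂ x≈0 = x≈0

  x*x≈1⇒x≈±1 : ∀ {x} → x * x ≈ 1# → x ≈ 1# ⊎ x ≈ - 1#
  x*x≈1⇒x≈±1 {x} x²≈1 with x*y≈0⇒x≈0∨y≈0 (trans
    (solve 1 (λ x → (x :- con (+ 1)) :* (x :+ con (+ 1)) := x :* x :- con (+ 1)) refl x) (x≈y⇒x-y≈0 x²≈1))
  ... | inj₁ x-1≈0 = inj₁ (x-y≈0⇒x≈y x-1≈0)
  ... | inj₂ x+1≈0 = inj₂ (x-y≈0⇒x≈y (trans (+-congˡ (-‿involutive 1#)) x+1≈0))

  x²+y²≈0⇒x≈0 : ∀ {x} y → x * x + y * y ≈ 0# → x ≈ 0#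
  x²+y²≈0⇒x≈0 {x} y eq with em {x ≈ 0#}
  ... | yes x≈0 = x≈0
  ... | no  x≉0 = ⊥-elim (x²+y²≉0ˡ y x≉0 eq)

  *-pos : ∀ {x y} → 0# < x → 0# < y → 0# < x * y
  *-pos {x} {y} 0<x 0<y = *-nonneg (proj₁ 0<x) (proj₁ 0<y) , 0≉xy
    where
    0≉xy : ¬ (0# ≈ x * y)
    0≉xy 0≈xy with x*y≈0⇒x≈0∨y≈0 (sym 0≈xy)
    ... | inj₁ x≈0 = 0<⇒≉0 0<x x≈0
    ... | inj₂ y≈0 = 0<⇒≉0 0<y y≈0

  *-cancelˡ-nonneg : ∀ {x y} → 0# < x → 0# ≤ x * y → 0# ≤ y
  *-cancelˡ-nonneg {x} {y} 0<x 0≤xy = let x⁻¹ , xx⁻¹≈1 = inverse x (0<⇒≉0 0<x) in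
    ≤-respʳ-≈ (≈-combine xx⁻¹≈1 y (solve 3 (λ x y i → i :* (x :* y) :- y := y :* (x :* i :- con (+ 1))) refl x y x⁻¹))
      (*-nonneg (inverse-nonneg (proj₁ 0<x) xx⁻¹≈1) 0≤xy)

  0<2 : 0# < 2#
  0<2 = <-≤-trans 0<1 (≤-+ʳ 1# (proj₁ 0<1))

  ½ : Carrier
  ½ = proj₁ (inverse 2# (0<⇒≉0 0<2))

  2*½≈1 : 2# * ½ ≈ 1#
  2*½≈1 = proj₂ (inverse 2# (0<⇒≉0 0<2))

  0<½ : 0# < ½
  0<½ = inverse-nonneg (proj₁ 0<2) 2*½≈1 , λ 0≈½ → 0≉1 (trans (sym (zeroʳ 2#)) (trans (*-congˡ 0≈½) 2*½≈1))

  -- The sign of the slope `m` decides which end bounds the value at `t` from below: the left end if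
  -- the function increases, the right end if it decreases.
  affine≥0-between : ∀ m k {p q t} → p ≤ t → t ≤ q →
    0# ≤ m * p + k → 0# ≤ m * q + k → 0# ≤ m * t + k
  affine≥0-between m k {p} {q} {t} p≤t t≤q 0≤fp 0≤fq with total 0# m
  ... | inj₁ 0≤m = ≤-respʳ-≈
    (solve 4 (λ m k p t → m :* p :+ k :+ m :* (t :- p) := m :* t :+ k) refl m k p t)
    (+-nonneg 0≤fp (*-nonneg 0≤m (x≤y⇒0≤y-x p≤t)))
  ... | inj₂ m≤0 = ≤-respʳ-≈
    (solve 4 (λ m k q t → m :* q :+ k :+ (con (+ 0) :- m) :* (q :- t) := m :* t :+ k) refl m k q t)
    (+-nonneg 0≤fq (*-nonneg (x≤y⇒0≤y-x m≤0) (x≤y⇒0≤y-x t≤q)))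

  -- On an interval a square is largest at an end: `q * q` dominates for `0# ≤ t` and `p * p` for
  -- `t ≤ 0#`. This later keeps points between two points of ℍ² on a semicircle off the real axis.
  square-between : ∀ {c p q t} → p ≤ t → t ≤ q → p * p < c → q * q < c → t * t < c
  square-between {c} {p} {q} {t} p≤t t≤q p²<c q²<c with total 0# t
  ... | inj₁ 0≤t = <-combine (<-≤-trans (x<y⇒0<y-x q²<c) (≤-+ʳ _ (*-nonneg (x≤y⇒0≤y-x t≤q) (+-nonneg (≤-trans 0≤t t≤q) 0≤t))))
    (solve 3 (λ c q t → c :- q :* q :+ (q :- t) :* (q :+ t) := c :- t :* t) refl c q t)
  ... | inj₂ t≤0 = <-combine (<-≤-trans (x<y⇒0<y-x p²<c) (≤-+ʳ _ (*-nonneg (x≤y⇒0≤y-x p≤t) (+-nonneg (x≤y⇒0≤y-x (≤-trans p≤t t≤0)) (x≤y⇒0≤y-x t≤0)))))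
    (solve 3 (λ c p t → c :- p :* p :+ (t :- p) :* (con (+ 0) :- p :+ (con (+ 0) :- t)) := c :- t :* t) refl c p t)

  -- The integers in the field, and the consequences of completeness.

  fromℤ≈⟦⟧ℤ : ∀ i → fromℤ i ≈ ⟦ i ⟧ℤ
  fromℤ≈⟦⟧ℤ (+ n)    = ×ᵤ≈× n 1#
  fromℤ≈⟦⟧ℤ -[1+ n ] = -‿cong (×ᵤ≈× (suc n) 1#)

  -- `fromℤ` is built from unoptimised multiples, so its laws are carried over from the solver's
  -- homomorphism through `fromℤ≈⟦⟧ℤ`.
  fromℤ-+ : ∀ i j → fromℤ (i ℤ.+ j) ≈ fromℤ i + fromℤ j
  fromℤ-+ i j = trans (fromℤ≈⟦⟧ℤ (i ℤ.+ j)) (trans (+-homo i j) (sym (+-cong (fromℤ≈⟦⟧ℤ i) (fromℤ≈⟦⟧ℤ j))))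

  fromℤ-* : ∀ i j → fromℤ (i ℤ.* j) ≈ fromℤ i * fromℤ j
  fromℤ-* i j = trans (fromℤ≈⟦⟧ℤ (i ℤ.* j)) (trans (*-homo i j) (sym (*-cong (fromℤ≈⟦⟧ℤ i) (fromℤ≈⟦⟧ℤ j))))

  fromℤ-neg : ∀ i → fromℤ (ℤ.- i) ≈ - fromℤ i
  fromℤ-neg i = trans (fromℤ≈⟦⟧ℤ (ℤ.- i)) (trans (-‿homo i) (-‿cong (sym (fromℤ≈⟦⟧ℤ i))))

  fromℤ-sub : ∀ i j → fromℤ (i ℤ.- j) ≈ fromℤ i - fromℤ j
  fromℤ-sub i j = trans (fromℤ-+ i (ℤ.- j)) (+-congˡ (fromℤ-neg j))

  IsInteger : Pred Carrier 0ℓ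
  IsInteger x = ∃[ n ] x ≈ fromℤ n

  IsInteger-resp : ∀ {x y} → x ≈ y → IsInteger x → IsInteger y
  IsInteger-resp x≈y (n , x≈n) = n , trans (sym x≈y) x≈n

  IsInteger-+ : ∀ {x y} → IsInteger x → IsInteger y → IsInteger (x + y)
  IsInteger-+ (m , x≈m) (n , y≈n) = m ℤ.+ n , trans (+-cong x≈m y≈n) (sym (fromℤ-+ m n))

  IsInteger-* : ∀ {x y} → IsInteger x → IsInteger y → IsInteger (x * y)
  IsInteger-* (m , x≈m) (n , y≈n) = m ℤ.* n , trans (*-cong x≈m y≈n) (sym (fromℤ-* m n))

  IsInteger-neg : ∀ {x} → IsInteger x → IsInteger (- x)
  IsInteger-neg (m , x≈m) = ℤ.- m , trans (-‿cong x≈m) (sym (fromℤ-neg m))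

  -- Recursion on the solver's own syntax: a single application shows a whole formula to be
  -- integral, and likewise every entry of a matrix of polynomials.
  polynomial-IsInteger : ∀ {k} (p : Polynomial k) ρ → (∀ i → IsInteger (lookup ρ i)) → IsInteger (⟦ p ⟧ ρ)
  polynomial-IsInteger (op [+] p q) ρ ρ∈ℤ = IsInteger-+ (polynomial-IsInteger p ρ ρ∈ℤ) (polynomial-IsInteger q ρ ρ∈ℤ)
  polynomial-IsInteger (op [*] p q) ρ ρ∈ℤ = IsInteger-* (polynomial-IsInteger p ρ ρ∈ℤ) (polynomial-IsInteger q ρ ρ∈ℤ)
  polynomial-IsInteger (con n)      ρ ρ∈ℤ = n , sym (fromℤ≈⟦⟧ℤ n)
  polynomial-IsInteger (var i)      ρ ρ∈ℤ = ρ∈ℤ i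
  polynomial-IsInteger (p :^ zero)  ρ ρ∈ℤ = + 1 , sym (+-identityʳ 1#)
  polynomial-IsInteger (p :^ suc k) ρ ρ∈ℤ = IsInteger-* (polynomial-IsInteger p ρ ρ∈ℤ) (polynomial-IsInteger (p :^ k) ρ ρ∈ℤ)
  polynomial-IsInteger (:- p)       ρ ρ∈ℤ = IsInteger-neg (polynomial-IsInteger p ρ ρ∈ℤ)

  1≤fromℤ[1+n] : ∀ n → 1# ≤ fromℤ (+ suc n)
  1≤fromℤ[1+n] zero    = ≤-+ʳ 1# ≤-refl
  1≤fromℤ[1+n] (suc n) = ≤-+ʳ 1# (≤-trans (proj₁ 0<1) (1≤fromℤ[1+n] n))

  -- The gap around 0 is the source of all discreteness arguments. Applied to a difference, it gives
  -- injectivity of `fromℤ` and separates distinct translates of [0,2].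
  fromℤ-discrete : ∀ i → i ≡ + 0 ⊎ 1# ≤ fromℤ i ⊎ fromℤ i ≤ - 1#
  fromℤ-discrete (+ zero)  = inj₁ ≡.refl
  fromℤ-discrete (+ suc n) = inj₂ (inj₁ (1≤fromℤ[1+n] n))
  fromℤ-discrete -[1+ n ]  = inj₂ (inj₂ (≤-combine (x≤y⇒0≤y-x (1≤fromℤ[1+n] n))
    (solve 1 (λ x → x :- con (+ 1) := (:- con (+ 1)) :- :- x) refl (fromℤ (+ suc n)))))

  1≰0 : ¬ (1# ≤ 0#)
  1≰0 = <⇒≱ 0<1

  0≰-1 : ¬ (0# ≤ - 1#)
  0≰-1 0≤-1 = 1≰0 (≤-combine 0≤-1 (solve 0 (:- con (+ 1) := con (+ 0) :- con (+ 1)) refl))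

  positive-integer≥1 : ∀ {x} → IsInteger x → 0# < x → 1# ≤ x
  positive-integer≥1 (n , x≈n) 0<x with fromℤ-discrete n
  ... | inj₁ ≡.refl       = ⊥-elim (0<⇒≉0 0<x x≈n)
  ... | inj₂ (inj₁ 1≤n)   = ≤-respʳ-≈ (sym x≈n) 1≤n
  ... | inj₂ (inj₂ n≤-1)  = ⊥-elim (0≰-1 (≤-trans (proj₁ 0<x) (≤-respˡ-≈ (sym x≈n) n≤-1)))

  fromℤ-injective : ∀ {i j} → fromℤ i ≈ fromℤ j → i ≡ j
  fromℤ-injective {i} {j} i≈j with fromℤ-discrete (i ℤ.- j) | trans (fromℤ-sub i j) (x≈y⇒x-y≈0 i≈j)
  ... | inj₁ i-j≡0         | _     = ℤ.i-j≡0⇒i≡j i j i-j≡0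
  ... | inj₂ (inj₁ 1≤i-j)  | i-j≈0 = ⊥-elim (1≰0 (≤-respʳ-≈ i-j≈0 1≤i-j))
  ... | inj₂ (inj₂ i-j≤-1) | i-j≈0 = ⊥-elim (0≰-1 (≤-respˡ-≈ i-j≈0 i-j≤-1))

  -- Otherwise `s - 1#` would be an upper bound smaller than the least one.
  least-exceeds : ∀ {P s} → (∀ {u} → UpperBound P u → s ≤ u) → ∃[ x ] x ∈ P × s - 1# < x
  least-exceeds {P} {s} least with em {∃[ x ] x ∈ P × s - 1# < x}
  ... | yes found = found
  ... | no  none  = ⊥-elim (0≰-1 (≤-combine (x≤y⇒0≤y-x (least {s - 1#} λ x∈P →
    ≮⇒≥ λ s-1<x → none (_ , x∈P , s-1<x)))
    (solve 1 (λ s → s :- con (+ 1) :- s := :- con (+ 1) :- con (+ 0)) refl s)))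

  fromℤ-suc : ∀ n → fromℤ (n ℤ.+ + 1) ≈ fromℤ n + 1#
  fromℤ-suc n = trans (fromℤ-+ n (+ 1)) (+-congˡ (+-identityʳ 1#))

  s-1<n⇒n+1≰s : ∀ {s x} n → s - 1# < x → x ≈ fromℤ n → ¬ (fromℤ (n ℤ.+ + 1) ≤ s)
  s-1<n⇒n+1≰s {s} {x} n s-1<x x≈n n+1≤s = <⇒≱ s-1<x (≤-respˡ-≈ (sym x≈n) (≤-combine (x≤y⇒0≤y-x n+1≤s)
    (trans (+-congˡ (-‿cong (fromℤ-suc n))) (solve 2 (λ s n → s :- (n :+ con (+ 1)) := s :- con (+ 1) :- n) refl s (fromℤ n)))))

  -- Some integer n exceeds s - 1 for the supremum s, and then n + 1 is an integer above s.
  integers-unbounded : ∀ {u} → ¬ UpperBound IsInteger u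
  integers-unbounded bound with supremum IsInteger (0# , + 0 , refl) (_ , bound)
  ... | s , upper , least with least-exceeds {IsInteger} least
  ... | x , (n , x≈n) , s-1<x = s-1<n⇒n+1≰s n s-1<x x≈n (upper (n ℤ.+ + 1 , refl))

  archimedean : ∀ t → ∃[ n ] t ≤ fromℤ n
  archimedean t with em {∃[ n ] t ≤ fromℤ n}
  ... | yes found = found
  ... | no  none  = ⊥-elim (integers-unbounded λ (n , x≈n) →
    ≰⇒≥ λ t≤x → none (n , ≤-respʳ-≈ x≈n t≤x))

  -- Let s be the supremum of the integers below t; the set is inhabited by - m, where m bounds - t.
  -- An integer n of the set with n > s - 1 is the answer, since n + 1 ≤ t would put n + 1 into the
  -- set and above s.
  floor : ∀ t → ∃[ n ] fromℤ n ≤ t × t ≤ fromℤ n + 1#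
  floor t with archimedean (- t)
  ... | m , -t≤m with supremum (λ x → IsInteger x × x ≤ t) (fromℤ (ℤ.- m) , (ℤ.- m , refl) , -m≤t) (t , proj₂)
    where
    -m≤t : fromℤ (ℤ.- m) ≤ t
    -m≤t = ≤-combine (x≤y⇒0≤y-x -t≤m) (trans (solve 2 (λ m t → m :- :- t := t :- :- m) refl (fromℤ m) t)
             (+-congˡ (-‿cong (sym (fromℤ-neg m)))))
  ... | s , upper , least with least-exceeds {λ x → IsInteger x × x ≤ t} least
  ... | x , ((n , x≈n) , x≤t) , s-1<x = n , ≤-respˡ-≈ x≈n x≤t , ≤-respʳ-≈ (fromℤ-suc n)
    (≰⇒≥ λ n+1≤t → s-1<n⇒n+1≰s n s-1<x x≈n (upper ((n ℤ.+ + 1 , refl) , n+1≤t)))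

  -- The supremum s of the x with x² ≤ c satisfies s² = c because the arithmetic
  -- mean of s and c/s is an upper bound, and their harmonic mean has square ≤ c.
  sqrt : ∀ {c} → 1# ≤ c → ∃[ s ] 1# ≤ s × s * s ≈ c
  sqrt {c} 1≤c = s , 1≤s , antisym s²≤c c≤s²
    where
    P : Pred Carrier 0ℓ
    P x = x * x ≤ c
    1∈P : 1# ∈ P
    1∈P = ≤-respˡ-≈ (sym (*-identityˡ 1#)) 1≤c
    -- Small x satisfy x ≤ 1 ≤ c, and x ≥ 1 gives x ≤ x² ≤ c.
    c-bound : UpperBound P c
    c-bound {x} x²≤c with total x 1#
    ... | inj₁ x≤1 = ≤-trans x≤1 1≤c
    ... | inj₂ 1≤x = ≤-trans (≤-combine (*-nonneg (≤-trans (proj₁ 0<1) 1≤x) (x≤y⇒0≤y-x 1≤x))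
            (solve 1 (λ x → x :* (x :- con (+ 1)) := x :* x :- x) refl x)) x²≤c
    sup = supremum P (1# , 1∈P) (c , c-bound)
    s = proj₁ sup
    1≤s : 1# ≤ s
    1≤s = proj₁ (proj₂ sup) 1∈P
    0<c : 0# < c
    0<c = <-≤-trans 0<1 1≤c
    0<s : 0# < s
    0<s = <-≤-trans 0<1 1≤s
    0<2s : 0# < 2# * s
    0<2s = *-pos 0<2 0<s
    i = proj₁ (inverse (2# * s) (0<⇒≉0 0<2s))
    2s*i≈1 : 2# * s * i ≈ 1#
    2s*i≈1 = proj₂ (inverse (2# * s) (0<⇒≉0 0<2s))
    am-bound : UpperBound P ((s * s + c) * i)
    am-bound {x} x²≤c = ≤-combine
      (*-nonneg (inverse-nonneg (proj₁ 0<2s) 2s*i≈1) (+-nonneg (x²≥0 (s - x)) (x≤y⇒0≤y-x x²≤c)))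
      (≈-combine 2s*i≈1 (- x) (solve 4 (λ s c i x →
        i :* ((s :- x) :* (s :- x) :+ (c :- x :* x)) :- ((s :* s :+ c) :* i :- x) :=
        :- x :* (con (+ 2) :* s :* i :- con (+ 1))) refl s c i x))
    s²≤c : s * s ≤ c
    s²≤c = ≤-combine (*-nonneg (proj₁ 0<2s) (x≤y⇒0≤y-x (proj₂ (proj₂ sup) am-bound)))
      (≈-combine 2s*i≈1 (s * s + c) (solve 3 (λ s c i →
        con (+ 2) :* s :* ((s :* s :+ c) :* i :- s) :- (c :- s :* s) :=
        (s :* s :+ c) :* (con (+ 2) :* s :* i :- con (+ 1))) refl s c i))
    0<s²+c : 0# < s * s + c
    0<s²+c = <-≤-trans 0<c (≤-respʳ-≈ (+-comm c _) (≤-+ʳ c (x²≥0 s)))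
    j = proj₁ (inverse (s * s + c) (0<⇒≉0 0<s²+c))
    [s²+c]*j≈1 : (s * s + c) * j ≈ 1#
    [s²+c]*j≈1 = proj₂ (inverse (s * s + c) (0<⇒≉0 0<s²+c))
    hm∈P : 2# * c * s * j ∈ P
    -- With h the harmonic mean, c - h² = c ((s² - c)/(s² + c))².
    hm∈P = ≤-combine (*-nonneg (proj₁ 0<c) (x²≥0 ((s * s - c) * j)))
      (≈-combine [s²+c]*j≈1 (c * ((s * s + c) * j + 1#)) (solve 3 (λ s c j →
        c :* ((s :* s :- c) :* j :* ((s :* s :- c) :* j)) :- (c :- con (+ 2) :* c :* s :* j :* (con (+ 2) :* c :* s :* j)) :=
        c :* ((s :* s :+ c) :* j :+ con (+ 1)) :* ((s :* s :+ c) :* j :- con (+ 1))) refl s c j))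
    c≤s² : c ≤ s * s
    -- Multiplying s - h ≥ 0 by s² + c gives s (s² - c) ≥ 0.
    c≤s² = 0≤y-x⇒x≤y (*-cancelˡ-nonneg 0<s (≤-respʳ-≈
      (≈-combine [s²+c]*j≈1 (- (2# * c * s)) (solve 3 (λ s c j →
        (s :* s :+ c) :* (s :- con (+ 2) :* c :* s :* j) :- s :* (s :* s :- c) :=
        :- (con (+ 2) :* c :* s) :* ((s :* s :+ c) :* j :- con (+ 1))) refl s c j))
      (*-nonneg (proj₁ 0<s²+c) (x≤y⇒0≤y-x (proj₁ (proj₂ sup) hm∈P)))))

-- Symbolic complex numbers and matrices for the solver.

module ComplexPolynomials (R : CommutativeRing 0ℓ 0ℓ) (m : ℕ) where
  open IntegerSolver R

  infix 5 _+i_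
  record Polynomialℂ : Set where
    constructor _+i_
    field
      reᵖ imᵖ : Polynomial m
  open Polynomialℂ public

  -- Evaluation turns these operations definitionally into those of ℂ, so that
  -- the ring solver applies to matrix entries without writing them out.
  polynomialℂ-rawRing : RawRing 0ℓ 0ℓ
  polynomialℂ-rawRing = record
    { Carrier = Polynomialℂ
    ; _≈_ = _≡_
    ; _+_ = λ z w → (reᵖ z :+ reᵖ w) +i (imᵖ z :+ imᵖ w)
    ; _*_ = λ z w → (reᵖ z :* reᵖ w :- imᵖ z :* imᵖ w) +i (reᵖ z :* imᵖ w :+ imᵖ z :* reᵖ w)
    ; -_  = λ z → (:- reᵖ z) +i (:- imᵖ z)
    ; 0#  = con (+ 0) +i con (+ 0)
    ; 1#  = con (+ 1) +i con (+ 0)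
    }

  open CommutativeRing R using (_≈_)
  open RawRing polynomialℂ-rawRing using (_+_; _*_; -_; 0#; 1#; +-rawMonoid)
  open Matrices polynomialℂ-rawRing public
  open RawMonoidDefs +-rawMonoid using (sum)

  proveℂ : ∀ ρ z w → ⟦ reᵖ z ⟧↓ ρ ≈ ⟦ reᵖ w ⟧↓ ρ → ⟦ imᵖ z ⟧↓ ρ ≈ ⟦ imᵖ w ⟧↓ ρ →
           (⟦ reᵖ z ⟧ ρ ≈ ⟦ reᵖ w ⟧ ρ) × (⟦ imᵖ z ⟧ ρ ≈ ⟦ imᵖ w ⟧ ρ)
  proveℂ ρ z w re≈ im≈ = prove ρ (reᵖ z) (reᵖ w) re≈ , prove ρ (imᵖ z) (imᵖ w) im≈

  realᵖ : Polynomial m → Polynomialℂ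
  realᵖ p = p +i con (+ 0)

  imaginaryᵖ : Polynomial m → Polynomialℂ
  imaginaryᵖ p = con (+ 0) +i p

  basisᵖ : Vector (Mat 2) 3
  basisᵖ = mat₂ 0# 1# 1# 0# ∷
           mat₂ 0# (imaginaryᵖ (con (+ 1))) (imaginaryᵖ (:- con (+ 1))) 0# ∷
           mat₂ 1# 0# 0# (- 1#) ∷ []

  Adᵖ : (a b c d : Polynomial m) → Mat 2 → Mat 2
  Adᵖ a b c d X =
    mat₂ (realᵖ a) (realᵖ b) (realᵖ c) (realᵖ d) *ᴹ X *ᴹ mat₂ (realᵖ d) (- realᵖ b) (- realᵖ c) (realᵖ a)

  -- Vanishes when v is column j of 𝐜 g, for g = (a b; c d).
  residualᵖ : (a b c d : Polynomial m) → Vector Polynomialℂ 3 → Fin 3 → Mat 2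
  residualᵖ a b c d v j k l = Adᵖ a b c d (basisᵖ j) k l + - sum λ i → v i * basisᵖ i k l

-- The entries of 𝐜 g for real g.

module Adjoint (em : ExcludedMiddle 0ℓ) (R : CompleteOrderedField) where
  open CompleteOrderedField R
  open UpperHalfPlane R
  open OrderedField em R

  private
    module P₁  = ComplexPolynomials commutativeRing 1
    module P₇  = ComplexPolynomials commutativeRing 7
    module P₁₀ = ComplexPolynomials commutativeRing 10

  module EntriesOf𝐜 (γ : SL₂ℝ) (M : Matℂ.Mat 3) (γ↦M : 𝐜 SL₂ℝ→SL₂ℂ γ ↦ M) where
    open SL₂ℝ γ
    open P₁₀

    private
      A B C D r₀ i₀ r₁ i₁ r₂ i₂ : Polynomial 10
      A = var 0F; B = var 1F; C = var 2F; D = var 3F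
      r₀ = var 4F; i₀ = var 5F; r₁ = var 6F; i₁ = var 7F; r₂ = var 8F; i₂ = var 9F

      env : Fin 3 → Vec ℝ 10
      env j = a ∷ᵛ b ∷ᵛ c ∷ᵛ d ∷ᵛ re (M 0F j) ∷ᵛ im (M 0F j) ∷ᵛ re (M 1F j) ∷ᵛ im (M 1F j) ∷ᵛ
        re (M 2F j) ∷ᵛ im (M 2F j) ∷ᵛ []ᵛ

      difference : Fin 3 → Mat 2
      difference = residualᵖ A B C D ((r₀ +i i₀) ∷ (r₁ +i i₁) ∷ (r₂ +i i₂) ∷ [])

    -- Each identity of this group is the real or imaginary part of one entry of the equation that
    -- defines a column of `M`. The coordinates are arbitrary complex numbers here, and X₂ carries a
    -- factor i, so off the diagonal the real part of one coordinate meets the imaginary part of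
    -- another.
    bd-ac : b * d - a * c ≈ re (M 2F 0F)
    bd-ac = ≈-combine (proj₁ (γ↦M 0F 0F 0F)) 1# (prove (env 0F)
      (B :* D :- A :* C :- r₂) (con (+ 1) :* reᵖ (difference 0F 0F 0F)) refl)

    d²-c² : d * d - c * c ≈ re (M 0F 0F) + im (M 1F 0F)
    d²-c² = ≈-combine (proj₁ (γ↦M 0F 1F 0F)) 1# (prove (env 0F)
      (D :* D :- C :* C :- (r₀ :+ i₁)) (con (+ 1) :* reᵖ (difference 0F 1F 0F)) refl)

    a²+b² : a * a + b * b ≈ re (M 1F 1F) + im (M 0F 1F)
    a²+b² = ≈-combine (proj₂ (γ↦M 1F 0F 1F)) 1# (prove (env 1F)
      (A :* A :+ B :* B :- (r₁ :+ i₀)) (con (+ 1) :* imᵖ (difference 1F 0F 1F)) refl)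

    c²+d² : c * c + d * d ≈ re (M 1F 1F) - im (M 0F 1F)
    c²+d² = ≈-combine (proj₂ (γ↦M 1F 1F 0F)) (- 1#) (prove (env 1F)
      (C :* C :+ D :* D :- (r₁ :- i₀)) (:- con (+ 1) :* imᵖ (difference 1F 1F 0F)) refl)

    2cd : 2# * (c * d) ≈ re (M 0F 2F) + im (M 1F 2F)
    2cd = ≈-combine (proj₁ (γ↦M 2F 1F 0F)) 1# (prove (env 2F)
      (con (+ 2) :* (C :* D) :- (r₀ :+ i₁)) (con (+ 1) :* reᵖ (difference 2F 1F 0F)) refl)

  -- All entries are integer polynomials in one integer `n`. Integrality then comes from
  -- `polynomial-IsInteger`, and orthogonality and the determinant become polynomial identities for
  -- the solver.
  module MatrixOf𝐜 (γ : SL₂ℝ) (n : ℤ) (p q u r s v w t k : Polynomial 1) where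
    open SL₂ℝ γ

    env : Vec ℝ 1
    env = fromℤ n ∷ᵛ []ᵛ

    -- For real g the entries of 𝐜 g are real or purely imaginary in this pattern,
    -- because X₂ is i times a real matrix while X₁ and Y are real.
    Mᵖ : P₁.Mat 3
    Mᵖ = (realᵖ p          ∷ imaginaryᵖ q      ∷ realᵖ u      ∷ []) ∷
         (imaginaryᵖ (:- r) ∷ realᵖ s           ∷ imaginaryᵖ v ∷ []) ∷
         (realᵖ w          ∷ imaginaryᵖ (:- t) ∷ realᵖ k      ∷ []) ∷ []
      where open P₁

    M : Matℂ.Mat 3
    M i j = ⟦ P₁.reᵖ (Mᵖ i j) ⟧ env +i ⟦ P₁.imᵖ (Mᵖ i j) ⟧ env

    module _
      (bd-ac : b * d - a * c ≈ ⟦ w ⟧ env)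
      (a²-b² : a * a - b * b ≈ ⟦ p ⟧ env + ⟦ r ⟧ env)
      (d²-c² : d * d - c * c ≈ ⟦ p ⟧ env - ⟦ r ⟧ env)
      (bd+ac : b * d + a * c ≈ ⟦ t ⟧ env)
      (a²+b² : a * a + b * b ≈ ⟦ s ⟧ env + ⟦ q ⟧ env)
      (c²+d² : c * c + d * d ≈ ⟦ s ⟧ env - ⟦ q ⟧ env)
      (ad+bc : a * d + b * c ≈ ⟦ k ⟧ env)
      (2ab   : 2# * (a * b)  ≈ ⟦ v ⟧ env - ⟦ u ⟧ env)
      (2cd   : 2# * (c * d)  ≈ ⟦ v ⟧ env + ⟦ u ⟧ env)
      where
      open P₇

      private
        A B C D m₀ m₁ m₂ : Polynomial 7
        A = var 0F; B = var 1F; C = var 2F; D = var 3F; m₀ = var 4F; m₁ = var 5F; m₂ = var 6F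

        -- Each identity sees a single column, so seven variables do: a, b, c, d and the three
        -- entries, with the signs and factors i of `Mᵖ`.
        column : Fin 3 → Vector Polynomialℂ 3
        column 0F = realᵖ m₀      ∷ imaginaryᵖ (:- m₁) ∷ realᵖ m₂           ∷ []
        column 1F = imaginaryᵖ m₀ ∷ realᵖ m₁           ∷ imaginaryᵖ (:- m₂) ∷ []
        column 2F = realᵖ m₀      ∷ imaginaryᵖ m₁      ∷ realᵖ m₂           ∷ []

        entries : (m₀ m₁ m₂ : ℝ) → Vec ℝ 7
        entries m₀ m₁ m₂ = a ∷ᵛ b ∷ᵛ c ∷ᵛ d ∷ᵛ m₀ ∷ᵛ m₁ ∷ᵛ m₂ ∷ᵛ []ᵛ

        ρ₀ ρ₁ ρ₂ : Vec ℝ 7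
        ρ₀ = entries (⟦ p ⟧ env) (⟦ r ⟧ env) (⟦ w ⟧ env)
        ρ₁ = entries (⟦ q ⟧ env) (⟦ s ⟧ env) (⟦ t ⟧ env)
        ρ₂ = entries (⟦ u ⟧ env) (⟦ v ⟧ env) (⟦ k ⟧ env)

        difference : Fin 3 → Mat 2
        difference j = residualᵖ A B C D (column j) j

      -- Of the two real equations in each complex entry, one holds identically and the other is a
      -- hypothesis up to sign. Nine hypotheses cover twelve entries because conjugates of the basis
      -- have trace zero, so their diagonal entries are opposite.
      γ↦M : 𝐜 SL₂ℝ→SL₂ℂ γ ↦ M
      γ↦M 0F 0F 0F = ≈-combine bd-ac 1#     (prove ρ₀ (reᵖ (difference 0F 0F 0F)) (con (+ 1) :* (B :* D :- A :* C :- m₂)) refl) ,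
                     x-y≈0⇒x≈y (prove ρ₀ (imᵖ (difference 0F 0F 0F)) (con (+ 0)) refl)
      γ↦M 0F 0F 1F = ≈-combine a²-b² 1#     (prove ρ₀ (reᵖ (difference 0F 0F 1F)) (con (+ 1) :* (A :* A :- B :* B :- (m₀ :+ m₁))) refl) ,
                     x-y≈0⇒x≈y (prove ρ₀ (imᵖ (difference 0F 0F 1F)) (con (+ 0)) refl)
      γ↦M 0F 1F 0F = ≈-combine d²-c² 1#     (prove ρ₀ (reᵖ (difference 0F 1F 0F)) (con (+ 1) :* (D :* D :- C :* C :- (m₀ :- m₁))) refl) ,
                     x-y≈0⇒x≈y (prove ρ₀ (imᵖ (difference 0F 1F 0F)) (con (+ 0)) refl)
      γ↦M 0F 1F 1F = ≈-combine bd-ac (- 1#) (prove ρ₀ (reᵖ (difference 0F 1F 1F)) (:- con (+ 1) :* (B :* D :- A :* C :- m₂)) refl) ,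
                     x-y≈0⇒x≈y (prove ρ₀ (imᵖ (difference 0F 1F 1F)) (con (+ 0)) refl)
      γ↦M 1F 0F 0F = x-y≈0⇒x≈y (prove ρ₁ (reᵖ (difference 1F 0F 0F)) (con (+ 0)) refl) ,
                     ≈-combine bd+ac (- 1#) (prove ρ₁ (imᵖ (difference 1F 0F 0F)) (:- con (+ 1) :* (B :* D :+ A :* C :- m₂)) refl)
      γ↦M 1F 0F 1F = x-y≈0⇒x≈y (prove ρ₁ (reᵖ (difference 1F 0F 1F)) (con (+ 0)) refl) ,
                     ≈-combine a²+b² 1#     (prove ρ₁ (imᵖ (difference 1F 0F 1F)) (con (+ 1) :* (A :* A :+ B :* B :- (m₁ :+ m₀))) refl)
      γ↦M 1F 1F 0F = x-y≈0⇒x≈y (prove ρ₁ (reᵖ (difference 1F 1F 0F)) (con (+ 0)) refl) ,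
                     ≈-combine c²+d² (- 1#) (prove ρ₁ (imᵖ (difference 1F 1F 0F)) (:- con (+ 1) :* (C :* C :+ D :* D :- (m₁ :- m₀))) refl)
      γ↦M 1F 1F 1F = x-y≈0⇒x≈y (prove ρ₁ (reᵖ (difference 1F 1F 1F)) (con (+ 0)) refl) ,
                     ≈-combine bd+ac 1#     (prove ρ₁ (imᵖ (difference 1F 1F 1F)) (con (+ 1) :* (B :* D :+ A :* C :- m₂)) refl)
      γ↦M 2F 0F 0F = ≈-combine ad+bc 1#     (prove ρ₂ (reᵖ (difference 2F 0F 0F)) (con (+ 1) :* (A :* D :+ B :* C :- m₂)) refl) ,
                     x-y≈0⇒x≈y (prove ρ₂ (imᵖ (difference 2F 0F 0F)) (con (+ 0)) refl)
      γ↦M 2F 0F 1F = ≈-combine 2ab (- 1#)   (prove ρ₂ (reᵖ (difference 2F 0F 1F)) (:- con (+ 1) :* (con (+ 2) :* (A :* B) :- (m₁ :- m₀))) refl) ,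
                     x-y≈0⇒x≈y (prove ρ₂ (imᵖ (difference 2F 0F 1F)) (con (+ 0)) refl)
      γ↦M 2F 1F 0F = ≈-combine 2cd 1#       (prove ρ₂ (reᵖ (difference 2F 1F 0F)) (con (+ 1) :* (con (+ 2) :* (C :* D) :- (m₁ :+ m₀))) refl) ,
                     x-y≈0⇒x≈y (prove ρ₂ (imᵖ (difference 2F 1F 0F)) (con (+ 0)) refl)
      γ↦M 2F 1F 1F = ≈-combine ad+bc (- 1#) (prove ρ₂ (reᵖ (difference 2F 1F 1F)) (:- con (+ 1) :* (A :* D :+ B :* C :- m₂)) refl) ,
                     x-y≈0⇒x≈y (prove ρ₂ (imᵖ (difference 2F 1F 1F)) (con (+ 0)) refl)

    env∈ℤ : ∀ i → IsInteger (lookup env i)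
    env∈ℤ 0F = n , refl

    integral : ∀ i j → M i j ∈ ℤ[i]
    integral i j =
      let m , re≈m = polynomial-IsInteger (P₁.reᵖ (Mᵖ i j)) env env∈ℤ
          l , im≈l = polynomial-IsInteger (P₁.imᵖ (Mᵖ i j)) env env∈ℤ
      in m , l , re≈m , im≈l

-- Passing to absolute values turns this into Euclid's lemma for the prime 2 in ℕ.
even-square : ∀ n k → n ℤ.* n ≡ + 2 ℤ.* k → ∃[ l ] n ≡ + 2 ℤ.* l
even-square n k n²≡2k = l , ≡.trans n≡l*2 (ℤ.*-comm l (+ 2))
  where
  2∣n² : 2 ∣ ℤ.∣ n ∣ ℕ.* ℤ.∣ n ∣
  2∣n² = divides ℤ.∣ k ∣ (≡.trans (≡.sym (ℤ.abs-* n n)) (≡.trans (≡.cong ℤ.∣_∣ n²≡2k)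
    (≡.trans (ℤ.abs-* (+ 2) k) (ℕ.*-comm 2 ℤ.∣ k ∣))))
  2∣n : + 2 ℤ.∣ n
  2∣n = ℤ.∣ᵤ⇒∣ ([ id , id ]′ (euclidsLemma ℤ.∣ n ∣ ℤ.∣ n ∣ prime[2] 2∣n²))
  open ℤ._∣_ 2∣n renaming (quotient to l; equality to n≡l*2)

-- Integrality in Γ, the even translations, and the element ι.

module Group (em : ExcludedMiddle 0ℓ) (R : CompleteOrderedField) where
  open CompleteOrderedField R
  open UpperHalfPlane R
  open OrderedField em R
  open Adjoint em R
  private module P₁ = ComplexPolynomials commutativeRing 1

  module Integrality (γ : SL₂ℝ) (γ∈Γ : γ ∈ Γℝ) where
    open SL₂ℝ γ
    private
      M : Matℂ.Mat 3
      M = proj₁ γ∈Γ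
      open EntriesOf𝐜 γ M (proj₁ (proj₂ γ∈Γ))

      re∈ℤ : ∀ i j → IsInteger (re (M i j))
      re∈ℤ i j = let m , _ , re≈m , _ = proj₂ (proj₂ (proj₂ γ∈Γ)) i j in m , re≈m

      im∈ℤ : ∀ i j → IsInteger (im (M i j))
      im∈ℤ i j = let _ , n , _ , im≈n = proj₂ (proj₂ (proj₂ γ∈Γ)) i j in n , im≈n

    c²+d²∈ℤ : IsInteger (c * c + d * d)
    c²+d²∈ℤ = IsInteger-resp (sym c²+d²) (IsInteger-+ (re∈ℤ 1F 1F) (IsInteger-neg (im∈ℤ 0F 1F)))

    d²-c²∈ℤ : IsInteger (d * d - c * c)
    d²-c²∈ℤ = IsInteger-resp (sym d²-c²) (IsInteger-+ (re∈ℤ 0F 0F) (im∈ℤ 1F 0F))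

    2cd∈ℤ : IsInteger (2# * (c * d))
    2cd∈ℤ = IsInteger-resp (sym 2cd) (IsInteger-+ (re∈ℤ 0F 2F) (im∈ℤ 1F 2F))

    bd-ac∈ℤ : IsInteger (b * d - a * c)
    bd-ac∈ℤ = IsInteger-resp (sym bd-ac) (re∈ℤ 2F 0F)

    -- a² + b² and c² + d² are the sum and the difference of the same two numbers, so adding them
    -- leaves twice the real part of one entry. This factor 2 is what later forces translations to
    -- be even.
    ½[a²+b²+c²+d²]∈ℤ : ∃[ m ] a * a + b * b + (c * c + d * d) ≈ 2# * fromℤ m
    ½[a²+b²+c²+d²]∈ℤ = let m , s≈m = re∈ℤ 1F 1F in m , trans (+-cong a²+b² c²+d²)
      (trans (solve 2 (λ s q → s :+ q :+ (s :- q) := con (+ 2) :* s) refl (re (M 1F 1F)) (im (M 0F 1F))) (*-congˡ s≈m))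

  -- γ = e (1 2n; 0 1) with e = ± 1.
  record IsTranslation (γ : SL₂ℝ) (n : ℤ) : Set where
    open SL₂ℝ γ
    field
      e    : ℝ
      e²≈1 : e * e ≈ 1#
      a≈e  : a ≈ e
      b≈e  : b ≈ e * (2# * fromℤ n)
      c≈0  : c ≈ 0#
      d≈e  : d ≈ e

  -- Both signs become one number `e` of square 1, so later calculations do not split into cases.
  ±Unipotent2ℤ⇒IsTranslation : ∀ {γ} (γ∈U : γ ∈ ±Unipotent2ℤ) → IsTranslation γ (proj₁ γ∈U)
  ±Unipotent2ℤ⇒IsTranslation (n , inj₁ γ≈U) = record
    { e = 1#
    ; e²≈1 = *-identityˡ 1#
    ; a≈e = γ≈U 0F 0F
    ; b≈e = trans (γ≈U 0F 1F) (sym (*-identityˡ _))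
    ; c≈0 = γ≈U 1F 0F
    ; d≈e = γ≈U 1F 1F
    }
  ±Unipotent2ℤ⇒IsTranslation (n , inj₂ γ≈-U) = record
    { e = - 1#
    ; e²≈1 = solve 0 (:- con (+ 1) :* :- con (+ 1) := con (+ 1)) refl
    ; a≈e = γ≈-U 0F 0F
    ; b≈e = trans (γ≈-U 0F 1F) (solve 1 (λ x → :- x := :- con (+ 1) :* x) refl _)
    ; c≈0 = trans (γ≈-U 1F 0F) -0#≈0#
    ; d≈e = γ≈-U 1F 1F
    }

  IsTranslation⇒±Unipotent2ℤ : ∀ {γ n} → IsTranslation γ n → γ ∈ ±Unipotent2ℤ
  IsTranslation⇒±Unipotent2ℤ {γ} {n} T with x*x≈1⇒x≈±1 (IsTranslation.e²≈1 T)
  ... | inj₁ e≈1 = let open IsTranslation T in n , inj₁ λ where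
    0F 0F → trans a≈e e≈1
    0F 1F → trans b≈e (trans (*-congʳ e≈1) (*-identityˡ _))
    1F 0F → c≈0
    1F 1F → trans d≈e e≈1
  ... | inj₂ e≈-1 = let open IsTranslation T in n , inj₂ λ where
    0F 0F → trans a≈e e≈-1
    0F 1F → trans b≈e (trans (*-congʳ e≈-1) (solve 1 (λ x → :- con (+ 1) :* x := :- x) refl _))
    1F 0F → trans c≈0 (sym -0#≈0#)
    1F 1F → trans d≈e e≈-1

  -- The entries of 𝐜 γ are quadratic in those of γ, so the sign cancels. The shift 2n makes b² =
  -- 4n², whence halves such as (a² - b² + d² - c²)/2 = 1 - 2n² are integers.
  IsTranslation⇒∈Γℝ : ∀ {γ n} → IsTranslation γ n → γ ∈ Γℝ
  IsTranslation⇒∈Γℝ {γ} {n} T = M , γ↦M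
      (trans (+-cong bd (-‿cong ac)) (solve 1 (λ n → con (+ 2) :* n :- con (+ 0) := con (+ 2) :* n) refl N))
      (trans (+-cong aa (-‿cong bb)) (solve 1 (λ n → con (+ 1) :- con (+ 2) :* n :* (con (+ 2) :* n) :=
        con (+ 1) :- con (+ 2) :* n :* n :+ :- (con (+ 2) :* n :* n)) refl N))
      (trans (+-cong dd (-‿cong cc)) (solve 1 (λ n → con (+ 1) :- con (+ 0) :=
        con (+ 1) :- con (+ 2) :* n :* n :- :- (con (+ 2) :* n :* n)) refl N))
      (trans (+-cong bd ac) (+-identityʳ _))
      (trans (+-cong aa bb) (solve 1 (λ n → con (+ 1) :+ con (+ 2) :* n :* (con (+ 2) :* n) :=
        con (+ 1) :+ con (+ 2) :* n :* n :+ con (+ 2) :* n :* n) refl N))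
      (trans (+-cong cc dd) (solve 1 (λ n → con (+ 0) :+ con (+ 1) :=
        con (+ 1) :+ con (+ 2) :* n :* n :- con (+ 2) :* n :* n) refl N))
      (trans (+-cong ad bc) (+-identityʳ 1#))
      (trans (*-congˡ ab) (solve 1 (λ n → con (+ 2) :* (con (+ 2) :* n) := con (+ 2) :* n :- :- (con (+ 2) :* n)) refl N))
      (trans (*-congˡ cd) (solve 1 (λ n → con (+ 2) :* con (+ 0) := con (+ 2) :* n :+ :- (con (+ 2) :* n)) refl N))
    , (orthogonal , P₁.proveℂ env (P₁.det₃ Mᵖ) (P₁.realᵖ (con (+ 1))) refl refl)
    , integral
    where
    open SL₂ℝ γ
    open IsTranslation T
    X 2X² : Polynomial 1
    X = var 0F
    2X² = con (+ 2) :* X :* X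
    open MatrixOf𝐜 γ n (con (+ 1) :- 2X²) 2X² (:- (con (+ 2) :* X)) (:- 2X²) (con (+ 1) :+ 2X²)
                       (con (+ 2) :* X) (con (+ 2) :* X) (con (+ 2) :* X) (con (+ 1))
    N : ℝ
    N = fromℤ n
    aa : a * a ≈ 1#
    aa = trans (*-cong a≈e a≈e) e²≈1
    ad : a * d ≈ 1#
    ad = trans (*-cong a≈e d≈e) e²≈1
    dd : d * d ≈ 1#
    dd = trans (*-cong d≈e d≈e) e²≈1
    e[ex]≈x : ∀ x → e * (e * x) ≈ x
    e[ex]≈x x = trans (sym (*-assoc e e x)) (trans (*-congʳ e²≈1) (*-identityˡ x))
    ab : a * b ≈ 2# * N
    ab = trans (*-cong a≈e b≈e) (e[ex]≈x _)
    bd : b * d ≈ 2# * N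
    bd = trans (*-cong b≈e d≈e) (trans (*-comm _ e) (e[ex]≈x _))
    bb : b * b ≈ 2# * N * (2# * N)
    bb = trans (*-cong b≈e b≈e) (trans (*-assoc e _ _) (trans
      (*-congˡ (solve 2 (λ e x → x :* (e :* x) := e :* (x :* x)) refl e (2# * N))) (e[ex]≈x _)))
    ac : a * c ≈ 0#
    ac = trans (*-congˡ c≈0) (zeroʳ a)
    bc : b * c ≈ 0#
    bc = trans (*-congˡ c≈0) (zeroʳ b)
    cc : c * c ≈ 0#
    cc = trans (*-congˡ c≈0) (zeroʳ c)
    cd : c * d ≈ 0#
    cd = trans (*-congʳ c≈0) (zeroˡ d)
    orthogonal : transpose M Matℂ.*ᴹ M Matℂ.≈ᴹ Matℂ.1ᴹ
    orthogonal = λ where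
        0F 0F → check 0F 0F refl refl
        0F 1F → check 0F 1F refl refl
        0F 2F → check 0F 2F refl refl
        1F 0F → check 1F 0F refl refl
        1F 1F → check 1F 1F refl refl
        1F 2F → check 1F 2F refl refl
        2F 0F → check 2F 0F refl refl
        2F 1F → check 2F 1F refl refl
        2F 2F → check 2F 2F refl refl
      where
      check = λ i j → P₁.proveℂ env ((transpose Mᵖ P₁.*ᴹ Mᵖ) i j) (P₁.1ᴹ i j)

  1≤2 : 1# ≤ 2#
  1≤2 = ≤-+ʳ 1# (proj₁ 0<1)

  √½ : ℝ
  √½ = √2 * ½
    where
    √2 : ℝ
    √2 = proj₁ (sqrt 1≤2)

  2*√½²≈1 : 2# * (√½ * √½) ≈ 1#
  2*√½²≈1 = let √2 , _ , √2²≈2 = sqrt 1≤2 in begin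
    2# * (√2 * ½ * (√2 * ½))    ≈⟨ solve 2 (λ s h → con (+ 2) :* (s :* h :* (s :* h)) := s :* s :* h :* (con (+ 2) :* h)) refl √2 ½ ⟩
    √2 * √2 * ½ * (2# * ½)      ≈⟨ *-cong (*-congʳ √2²≈2) 2*½≈1 ⟩
    2# * ½ * 1#                 ≈⟨ *-identityʳ _ ⟩
    2# * ½                      ≈⟨ 2*½≈1 ⟩
    1#                          ∎
    where open SetoidReasoning setoid

  -- The inversion in the circle |z − 1| = √2 followed by z ↦ − z̄, which is the
  -- element of Γℝ whose isometric circle bounds the fundamental domain.
  ι : SL₂ℝ
  ι = record
    { mat   = Matℝ.mat₂ (- √½) (- √½) √½ (- √½)
    ; det≈1 = trans (solve 1 (λ h → :- h :* :- h :+ :- (:- h :* h) := con (+ 2) :* (h :* h)) refl √½) 2*√½²≈1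
    }

  -- 𝐜 ι is the quarter turn that fixes X₂ and sends X₁ to Y and Y to - X₁. Its entries are
  -- constants, so the integer parameter is set to 0.
  ι∈Γℝ : ι ∈ Γℝ
  ι∈Γℝ = M , γ↦M
      (≈-combine 2*√½²≈1 1# (solve 1 (λ h → :- h :* :- h :- :- h :* h :- con (+ 1) := con (+ 1) :* (con (+ 2) :* (h :* h) :- con (+ 1))) refl √½))
      (solve 1 (λ h → :- h :* :- h :- :- h :* :- h := con (+ 0) :+ con (+ 0)) refl √½)
      (solve 1 (λ h → :- h :* :- h :- h :* h := con (+ 0) :- con (+ 0)) refl √½)
      (solve 1 (λ h → :- h :* :- h :+ :- h :* h := con (+ 0)) refl √½)
      (≈-combine 2*√½²≈1 1# (solve 1 (λ h → :- h :* :- h :+ :- h :* :- h :- (con (+ 1) :+ con (+ 0)) := con (+ 1) :* (con (+ 2) :* (h :* h) :- con (+ 1))) refl √½))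
      (≈-combine 2*√½²≈1 1# (solve 1 (λ h → h :* h :+ :- h :* :- h :- (con (+ 1) :- con (+ 0)) := con (+ 1) :* (con (+ 2) :* (h :* h) :- con (+ 1))) refl √½))
      (solve 1 (λ h → :- h :* :- h :+ :- h :* h := con (+ 0)) refl √½)
      (≈-combine 2*√½²≈1 1# (solve 1 (λ h → con (+ 2) :* (:- h :* :- h) :- (con (+ 0) :- :- con (+ 1)) := con (+ 1) :* (con (+ 2) :* (h :* h) :- con (+ 1))) refl √½))
      (≈-combine 2*√½²≈1 (- 1#) (solve 1 (λ h → con (+ 2) :* (h :* :- h) :- (con (+ 0) :+ :- con (+ 1)) := :- con (+ 1) :* (con (+ 2) :* (h :* h) :- con (+ 1))) refl √½))
    , (orthogonal , P₁.proveℂ env (P₁.det₃ Mᵖ) (P₁.realᵖ (con (+ 1))) refl refl)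
    , integral
    where
    open MatrixOf𝐜 ι (+ 0) (con (+ 0)) (con (+ 0)) (:- con (+ 1)) (con (+ 0)) (con (+ 1))
                           (con (+ 0)) (con (+ 1)) (con (+ 0)) (con (+ 0))
    orthogonal : transpose M Matℂ.*ᴹ M Matℂ.≈ᴹ Matℂ.1ᴹ
    orthogonal = λ where
        0F 0F → check 0F 0F refl refl
        0F 1F → check 0F 1F refl refl
        0F 2F → check 0F 2F refl refl
        1F 0F → check 1F 0F refl refl
        1F 1F → check 1F 1F refl refl
        1F 2F → check 1F 2F refl refl
        2F 0F → check 2F 0F refl refl
        2F 1F → check 2F 1F refl refl
        2F 2F → check 2F 2F refl refl
      where
      check = λ i j → P₁.proveℂ env ((transpose Mᵖ P₁.*ᴹ Mᵖ) i j) (P₁.1ᴹ i j)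

-- The action on heights and abscissae.

module Action (em : ExcludedMiddle 0ℓ) (R : CompleteOrderedField) where
  open CompleteOrderedField R
  open UpperHalfPlane R
  open OrderedField em R
  open Group em R

  module _ (γ : SL₂ℝ) (z : ℍ²) where
    open SL₂ℝ γ

    N : ℝ
    N = ∥ denominator γ z ∥²

    private
      num*den‾ : ℂ
      num*den‾ = numerator γ z ℂᵣ.* denominator γ z ‾
      N⁻¹ : ℝ
      N⁻¹ = proj₁ (inverse N (denominator≉0 γ z))
      N*N⁻¹≈1 : N * N⁻¹ ≈ 1#
      N*N⁻¹≈1 = proj₂ (inverse N (denominator≉0 γ z))

    y•*N≈y : y (γ • z) * N ≈ y z
    y•*N≈y = trans (≈-combine N*N⁻¹≈1 (im num*den‾) (solve 4
        (λ r i n m → (r :* con (+ 0) :+ i :* m) :* n :- i := i :* (n :* m :- con (+ 1)))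
        refl (re num*den‾) (im num*den‾) N N⁻¹))
      (im-numerator*denominator‾ γ z)

    x•*N≈ : x (γ • z) * N ≈ (a * x z + b) * (c * x z + d) + a * y z * (c * y z)
    x•*N≈ = ≈-combine N*N⁻¹≈1 ((a * x z + b) * (c * x z + d) + a * y z * (c * y z)) (solve 6
      (λ p q r s n m → ((p :* r :- q :* :- s) :* m :- (p :* :- s :+ q :* r) :* con (+ 0)) :* n :- (p :* r :+ q :* s) :=
        (p :* r :+ q :* s) :* (n :* m :- con (+ 1)))
      refl (a * x z + b) (a * y z) (c * x z + d) (c * y z) N N⁻¹)

    y•≤y⇒1≤N : y (γ • z) ≤ y z → 1# ≤ N
    y•≤y⇒1≤N y•≤y = 0≤y-x⇒x≤y (*-cancelˡ-nonneg (y>0 (γ • z)) (≤-respʳ-≈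
      (trans (+-congʳ (sym y•*N≈y)) (solve 2 (λ h n → h :* n :- h := h :* (n :- con (+ 1))) refl (y (γ • z)) N))
      (x≤y⇒0≤y-x y•≤y)))

    1≤N⇒y•≤y : 1# ≤ N → y (γ • z) ≤ y z
    1≤N⇒y•≤y 1≤N = ≤-respʳ-≈ y•*N≈y (≤-combine (*-nonneg (proj₁ (y>0 (γ • z))) (x≤y⇒0≤y-x 1≤N))
      (solve 2 (λ h n → h :* (n :- con (+ 1)) := h :* n :- h) refl (y (γ • z)) N))

    y•≈y⇒N≈1 : y (γ • z) ≈ y z → N ≈ 1#
    y•≈y⇒N≈1 y•≈y = antisym (0≤y-x⇒x≤y (*-cancelˡ-nonneg (y>0 (γ • z)) (≤-reflexive (sym (trans
        (solve 2 (λ h n → h :* (con (+ 1) :- n) := h :- h :* n) refl (y (γ • z)) N)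
        (x≈y⇒x-y≈0 (trans y•≈y (sym y•*N≈y))))))))
      (y•≤y⇒1≤N (≤-reflexive y•≈y))

    N≈1⇒y•≈y : N ≈ 1# → y (γ • z) ≈ y z
    N≈1⇒y•≈y N≈1 = trans (sym (*-identityʳ _)) (trans (*-congˡ (sym N≈1)) y•*N≈y)

  module _ {γ n} (T : IsTranslation γ n) (z : ℍ²) where
    open SL₂ℝ γ
    open IsTranslation T

    private
      cx+d≈e : c * x z + d ≈ e
      cx+d≈e = trans (+-cong (trans (*-congʳ c≈0) (zeroˡ _)) d≈e) (+-identityˡ e)

      cy≈0 : c * y z ≈ 0#
      cy≈0 = trans (*-congʳ c≈0) (zeroˡ _)

    translation-N : N γ z ≈ 1#
    translation-N = trans (+-cong (*-cong cx+d≈e cx+d≈e) (*-cong cy≈0 cy≈0))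
      (trans (+-cong e²≈1 (zeroˡ 0#)) (+-identityʳ 1#))

    translation-x : x (γ • z) ≈ x z + 2# * fromℤ n
    translation-x = begin
      x (γ • z)                                                   ≈⟨ *-identityʳ _ ⟨
      x (γ • z) * 1#                                              ≈⟨ *-congˡ translation-N ⟨
      x (γ • z) * N γ z                                           ≈⟨ x•*N≈ γ z ⟩
      (a * x z + b) * (c * x z + d) + a * y z * (c * y z)         ≈⟨ +-cong (*-cong (+-cong (*-congʳ a≈e) b≈e) cx+d≈e) (*-congˡ cy≈0) ⟩
      (e * x z + e * (2# * fromℤ n)) * e + a * y z * 0#           ≈⟨ +-congˡ (zeroʳ _) ⟩
      (e * x z + e * (2# * fromℤ n)) * e + 0#
        ≈⟨ ≈-combine e²≈1 (x z + 2# * fromℤ n) (solve 3 (λ e x t → (e :* x :+ e :* t) :* e :+ con (+ 0) :- (x :+ t) :=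
             (x :+ t) :* (e :* e :- con (+ 1))) refl e (x z) (2# * fromℤ n)) ⟩
      x z + 2# * fromℤ n                                          ∎
      where open SetoidReasoning setoid

  -- The stabilizer of the height consists of even translations up to sign.

  module _ {γ} (γ∈H : γ ∈ HeightStabilizer) where
    open SL₂ℝ γ
    open Integrality γ (proj₁ γ∈H)

    private
      2𝐢 : ℍ²
      2𝐢 = 0# +i 2# ⟨ 0<2 ⟩

      N≈1 : ∀ z → N γ z ≈ 1#
      N≈1 z = y•≈y⇒N≈1 γ z (proj₂ γ∈H z)

    stabilizer⇒c≈0 : c ≈ 0#
    stabilizer⇒c≈0 = [ (λ 3≈0 → ⊥-elim (0<⇒≉0 0<3 3≈0)) , x*x≈0⇒x≈0 ]′ (x*y≈0⇒x≈0∨y≈0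
      -- The value of |cz + d|² at 2i exceeds that at i by 3c².
      (≈-combine (trans (N≈1 2𝐢) (sym (N≈1 𝐢))) 1# (solve 2 (λ c d → con (+ 3) :* (c :* c) :- con (+ 0) :=
        con (+ 1) :* ((c :* con (+ 0) :+ d) :* (c :* con (+ 0) :+ d) :+ c :* con (+ 2) :* (c :* con (+ 2)) :-
          ((c :* con (+ 0) :+ d) :* (c :* con (+ 0) :+ d) :+ c :* con (+ 1) :* (c :* con (+ 1))))) refl c d)))
      where
      0<3 : 0# < 2# + 1#
      0<3 = <-≤-trans 0<2 (≤-+ʳ 2# (proj₁ 0<1))

    stabilizer⇒d²≈1 : d * d ≈ 1#
    stabilizer⇒d²≈1 = trans (solve 2 (λ c d → d :* d := (con (+ 0) :* con (+ 0) :+ d) :* (con (+ 0) :* con (+ 0) :+ d) :+ con (+ 0) :* con (+ 1) :* (con (+ 0) :* con (+ 1))) refl c d)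
      (trans (+-cong (*-cong c0+d c0+d) (*-cong c1 c1)) (N≈1 𝐢))
      where
      c0+d : 0# * 0# + d ≈ c * 0# + d
      c0+d = +-congʳ (*-congʳ (sym stabilizer⇒c≈0))
      c1 : 0# * 1# ≈ c * 1#
      c1 = *-congʳ (sym stabilizer⇒c≈0)

    stabilizer⇒a≈d : a ≈ d
    stabilizer⇒a≈d = begin
      a                        ≈⟨ *-identityʳ a ⟨
      a * 1#                   ≈⟨ *-congˡ stabilizer⇒d²≈1 ⟨
      a * (d * d)              ≈⟨ solve 3 (λ a b d → a :* (d :* d) := (a :* d :+ :- (b :* con (+ 0))) :* d) refl a b d ⟩
      (a * d + - (b * 0#)) * d ≈⟨ *-congʳ (+-congˡ (-‿cong (*-congˡ stabilizer⇒c≈0))) ⟨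
      (a * d + - (b * c)) * d  ≈⟨ *-congʳ det≈1 ⟩
      1# * d                   ≈⟨ *-identityˡ d ⟩
      d                        ∎
      where open SetoidReasoning setoid

    -- As c = 0, the integer k = bd - ac is bd, and d² = 1 gives b = dk. The sum a² + b² + c² + d²
    -- is 2 + k² and also 2m, so k² = 2(m - 1) and k is even. The sign `e` is d.
    stabilizer⇒IsTranslation : ∃[ n ] IsTranslation γ n
    stabilizer⇒IsTranslation = l , record
      { e = d ; e²≈1 = stabilizer⇒d²≈1 ; a≈e = stabilizer⇒a≈d
      ; b≈e = trans b≈dk (*-congˡ (trans (reflexive (≡.cong fromℤ k≡2l)) (trans (fromℤ-* (+ 2) l) (*-congʳ fromℤ-2))))
      ; c≈0 = stabilizer⇒c≈0 ; d≈e = refl }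
      where
      open SetoidReasoning setoid
      fromℤ-2 : fromℤ (+ 2) ≈ 2#
      fromℤ-2 = +-congˡ (+-identityʳ 1#)
      k m : ℤ
      k = proj₁ bd-ac∈ℤ
      m = proj₁ ½[a²+b²+c²+d²]∈ℤ
      bd≈k : b * d ≈ fromℤ k
      bd≈k = begin
        b * d            ≈⟨ solve 3 (λ a b d → b :* d := b :* d :- a :* con (+ 0)) refl a b d ⟩
        b * d - a * 0#   ≈⟨ +-congˡ (-‿cong (*-congˡ stabilizer⇒c≈0)) ⟨
        b * d - a * c    ≈⟨ proj₂ bd-ac∈ℤ ⟩
        fromℤ k          ∎
      b≈dk : b ≈ d * fromℤ k
      b≈dk = begin
        b            ≈⟨ *-identityʳ b ⟨
        b * 1#       ≈⟨ *-congˡ stabilizer⇒d²≈1 ⟨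
        b * (d * d)  ≈⟨ solve 2 (λ b d → b :* (d :* d) := d :* (b :* d)) refl b d ⟩
        d * (b * d)  ≈⟨ *-congˡ bd≈k ⟩
        d * fromℤ k  ∎
      k²≈2[m-1] : fromℤ (k ℤ.* k) ≈ fromℤ (+ 2 ℤ.* (m ℤ.- + 1))
      k²≈2[m-1] = begin
        fromℤ (k ℤ.* k)            ≈⟨ fromℤ-* k k ⟩
        fromℤ k * fromℤ k          ≈⟨ *-cong bd≈k bd≈k ⟨
        b * d * (b * d)            ≈⟨ solve 2 (λ b d → b :* d :* (b :* d) := b :* b :* (d :* d)) refl b d ⟩
        b * b * (d * d)            ≈⟨ *-congˡ stabilizer⇒d²≈1 ⟩
        b * b * 1#                 ≈⟨ solve 1 (λ b → b :* b :* con (+ 1) := con (+ 1) :+ b :* b :+ (con (+ 0) :* con (+ 0) :+ con (+ 1)) :- con (+ 2)) refl b ⟩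
        1# + b * b + (0# * 0# + 1#) - 2#
          ≈⟨ +-congʳ (+-cong (+-congʳ (trans (*-cong stabilizer⇒a≈d stabilizer⇒a≈d) stabilizer⇒d²≈1))
                             (+-cong (*-cong stabilizer⇒c≈0 stabilizer⇒c≈0) stabilizer⇒d²≈1)) ⟨
        a * a + b * b + (c * c + d * d) - 2#  ≈⟨ +-congʳ (proj₂ ½[a²+b²+c²+d²]∈ℤ) ⟩
        2# * fromℤ m - 2#          ≈⟨ solve 1 (λ m → con (+ 2) :* m :- con (+ 2) := con (+ 2) :* (m :- con (+ 1))) refl (fromℤ m) ⟩
        2# * (fromℤ m - 1#)        ≈⟨ *-cong fromℤ-2 (trans (fromℤ-sub m (+ 1)) (+-congˡ (-‿cong (+-identityʳ 1#)))) ⟨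
        fromℤ (+ 2) * fromℤ (m ℤ.- + 1)  ≈⟨ fromℤ-* (+ 2) (m ℤ.- + 1) ⟨
        fromℤ (+ 2 ℤ.* (m ℤ.- + 1))  ∎
      even = even-square k (m ℤ.- + 1) (fromℤ-injective k²≈2[m-1])
      l = proj₁ even
      k≡2l = proj₂ even

  heightStabilizer : HeightStabilizer ≐ ±Unipotent2ℤ
  heightStabilizer =
    (λ {γ} γ∈H → IsTranslation⇒±Unipotent2ℤ {γ} (proj₂ (stabilizer⇒IsTranslation γ∈H))) ,
    (λ {γ} γ∈U → let T = ±Unipotent2ℤ⇒IsTranslation {γ} γ∈U in
      IsTranslation⇒∈Γℝ T , λ z → N≈1⇒y•≈y γ z (translation-N T z))

  -- The points of maximal height above [0,2].

  ℱℝ⊆CircleRegion : ℱℝ 𝒢ℝ ⊆ CircleRegion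
  ℱℝ⊆CircleRegion {z} (z∈ℱ₁ , 0≤x , x≤2) = 0≤x , x≤2 , ≤-combine
    (*-nonneg (proj₁ 0<2) (x≤y⇒0≤y-x (y•≤y⇒1≤N ι z (z∈ℱ₁ ι ι∈Γℝ))))
    (≈-combine 2*√½²≈1 (y z * y z + (x z - 1#) * (x z - 1#)) (solve 3 (λ x y h →
      con (+ 2) :* ((h :* x :+ :- h) :* (h :* x :+ :- h) :+ h :* y :* (h :* y) :- con (+ 1)) :-
        (y :* y :+ (x :- con (+ 1)) :* (x :- con (+ 1)) :- con (+ 2)) :=
      (y :* y :+ (x :- con (+ 1)) :* (x :- con (+ 1))) :* (con (+ 2) :* (h :* h) :- con (+ 1))) refl (x z) (y z) √½))

  CircleRegion⊆ℱℝ : CircleRegion ⊆ ℱℝ 𝒢ℝ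
  CircleRegion⊆ℱℝ {z} (0≤x , x≤2 , 2≤y²+[x-1]²) = (λ γ γ∈Γ → 1≤N⇒y•≤y γ z (1≤N γ γ∈Γ)) , 0≤x , x≤2
    where
    module _ (γ : SL₂ℝ) (γ∈Γ : γ ∈ Γℝ) where
      open SL₂ℝ γ
      open Integrality γ γ∈Γ

      ¬[c≈0×d≈0] : c ≈ 0# → ¬ (d ≈ 0#)
      ¬[c≈0×d≈0] c≈0 d≈0 = 0≉1 (trans (solve 2 (λ a b → con (+ 0) := a :* con (+ 0) :+ :- (b :* con (+ 0))) refl a b)
        (trans (+-cong (*-congˡ (sym d≈0)) (-‿cong (*-congˡ (sym c≈0)))) det≈1))

      -- |cz + d|² at z = i and at z = 2 + i
      N₀ N₂ : ℝ
      N₀ = c * c + d * d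
      N₂ = c * c + (2# * c + d) * (2# * c + d)

      1≤N₀ : 1# ≤ N₀
      1≤N₀ = positive-integer≥1 c²+d²∈ℤ (+-nonneg (x²≥0 c) (x²≥0 d) , λ 0≈N₀ →
        ¬[c≈0×d≈0] (x²+y²≈0⇒x≈0 d (sym 0≈N₀)) (x²+y²≈0⇒x≈0 c (trans (+-comm _ _) (sym 0≈N₀))))

      -- N₂ = 5c² + 4cd + d² is rewritten in known integers as 3(c² + d²) - 2(d² - c²) + 2(2cd).
      N₂∈ℤ : IsInteger N₂
      N₂∈ℤ = IsInteger-resp (solve 2 (λ c d →
          con (+ 3) :* (c :* c :+ d :* d) :+ con (+ 2) :* (:- (d :* d :- c :* c) :+ con (+ 2) :* (c :* d)) :=
          c :* c :+ (con (+ 2) :* c :+ d) :* (con (+ 2) :* c :+ d)) refl c d)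
        (polynomial-IsInteger (con (+ 3) :* var 0F :+ con (+ 2) :* (:- var 1F :+ var 2F)) (c * c + d * d ∷ᵛ d * d - c * c ∷ᵛ 2# * (c * d) ∷ᵛ []ᵛ) λ where
          0F → c²+d²∈ℤ
          1F → d²-c²∈ℤ
          2F → 2cd∈ℤ)

      1≤N₂ : 1# ≤ N₂
      1≤N₂ = positive-integer≥1 N₂∈ℤ (+-nonneg (x²≥0 c) (x²≥0 _) , λ 0≈N₂ →
        let c≈0 = x²+y²≈0⇒x≈0 _ (sym 0≈N₂) in
        ¬[c≈0×d≈0] c≈0 (begin
          d            ≈⟨ solve 1 (λ d → d := con (+ 2) :* con (+ 0) :+ d) refl d ⟩
          2# * 0# + d  ≈⟨ +-congʳ (*-congˡ c≈0) ⟨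
          2# * c + d   ≈⟨ x²+y²≈0⇒x≈0 c (trans (+-comm _ _) (sym 0≈N₂)) ⟩
          0#           ∎))
        where open SetoidReasoning setoid

      1≤N : 1# ≤ N γ z
      1≤N = 0≤y-x⇒x≤y (*-cancelˡ-nonneg 0<2 (≤-respʳ-≈
        (solve 4 (λ x y c d →
          con (+ 2) :* (c :* c :* (y :* y :+ (x :- con (+ 1)) :* (x :- con (+ 1)) :- con (+ 2))) :+
            ((con (+ 2) :- x) :* (c :* c :+ d :* d :- con (+ 1)) :+
             -- Subtracting 0 keeps the shape in which `x≤y⇒0≤y-x` delivers the factor.
             (x :- con (+ 0)) :* (c :* c :+ (con (+ 2) :* c :+ d) :* (con (+ 2) :* c :+ d) :- con (+ 1))) :=
          con (+ 2) :* ((c :* x :+ d) :* (c :* x :+ d) :+ c :* y :* (c :* y) :- con (+ 1))) refl (x z) (y z) c d)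
        (+-nonneg (*-nonneg (proj₁ 0<2) (*-nonneg (x²≥0 c) (x≤y⇒0≤y-x 2≤y²+[x-1]²)))
          (+-nonneg (*-nonneg (x≤y⇒0≤y-x x≤2) (x≤y⇒0≤y-x 1≤N₀))
                    (*-nonneg (x≤y⇒0≤y-x 0≤x) (x≤y⇒0≤y-x 1≤N₂))))))

  ℱℝ≐CircleRegion : ℱℝ 𝒢ℝ ≐ CircleRegion
  ℱℝ≐CircleRegion = (λ {z} → ℱℝ⊆CircleRegion {z}) , λ {z} → CircleRegion⊆ℱℝ {z}

-- The interval [0,2] as a fundamental domain on ℝ.

module FundamentalInterval (em : ExcludedMiddle 0ℓ) (R : CompleteOrderedField) where
  open CompleteOrderedField R
  open UpperHalfPlane R
  open OrderedField em R
  open Group em R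
  open Action em R

  halve-pos : ∀ {ε} → 0# < ε → 0# < ε * ½
  halve-pos 0<ε = *-pos 0<ε 0<½

  ½+½≈id : ∀ ε → ε * ½ + ε * ½ ≈ ε
  ½+½≈id ε = ≈-combine 2*½≈1 ε
    (solve 2 (λ e h → e :* h :+ e :* h :- e := e :* (con (+ 2) :* h :- con (+ 1))) refl ε ½)

  ε½<ε : ∀ {ε} → 0# < ε → ε * ½ < ε
  ε½<ε {ε} 0<ε = <-combine (halve-pos 0<ε) (trans
    (solve 1 (λ h → h := h :+ h :- h) refl (ε * ½)) (+-congʳ (½+½≈id ε)))

  t<t+δ : ∀ t {δ} → 0# < δ → t < t + δ
  t<t+δ t {δ} 0<δ = <-combine 0<δ (solve 2 (λ t d → d := t :+ d :- t) refl t δ)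

  t-δ<t : ∀ t {δ} → 0# < δ → t - δ < t
  t-δ<t t {δ} 0<δ = <-combine 0<δ (solve 2 (λ t d → d := t :- (t :- d)) refl t δ)

  t+δ<t+ε : ∀ t {δ ε} → δ < ε → t + δ < t + ε
  t+δ<t+ε t {δ} {ε} δ<ε = <-combine (x<y⇒0<y-x δ<ε) (solve 3 (λ t d e → e :- d := t :+ e :- (t :+ d)) refl t δ ε)

  t-ε<t-δ : ∀ t {δ ε} → δ < ε → t - ε < t - δ
  t-ε<t-δ t {δ} {ε} δ<ε = <-combine (x<y⇒0<y-x δ<ε) (solve 3 (λ t d e → e :- d := t :- d :- (t :- e)) refl t δ ε)

  <-trans : ∀ {x y z} → x < y → y < z → x < z
  <-trans x<y (y≤z , _) = <-≤-trans x<y y≤z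

  -- Half of the lesser of ε and 1. The bound by 1 keeps a step from one half of [0,2] towards the
  -- other short of the far end.
  smaller : ∀ {ε} → 0# < ε → ∃[ δ ] 0# < δ × δ < ε × δ < 1#
  smaller {ε} 0<ε with total ε 1#
  ... | inj₁ ε≤1 = ε * ½ , halve-pos 0<ε , ε½<ε 0<ε , <-≤-trans (ε½<ε 0<ε) ε≤1
  ... | inj₂ 1≤ε = 1# * ½ , halve-pos 0<1 , <-≤-trans (ε½<ε 0<1) 1≤ε , ε½<ε 0<1

  module _ {U : Pred ℝ 0ℓ} (U-open : OpenInℝ U) {t : ℝ} (t∈U : t ∈ U) where
    private
      ε : ℝ
      ε = proj₁ (U-open t∈U)
      0<ε : 0# < ε
      0<ε = proj₁ (proj₂ (U-open t∈U))

    -- One of the two neighbours leaves [0,2] when t is an endpoint, and one of them enters its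
    -- interior when t is in [0,2].
    open-both-sides : ∃[ δ ] 0# < δ × δ < 1# × t + δ ∈ U × t - δ ∈ U
    open-both-sides = let δ , 0<δ , δ<ε , δ<1 = smaller 0<ε in
      δ , 0<δ , δ<1 ,
      proj₂ (proj₂ (U-open t∈U)) (t + δ) (<-trans (t-δ<t t 0<ε) (t<t+δ t 0<δ)) (t+δ<t+ε t δ<ε) ,
      proj₂ (proj₂ (U-open t∈U)) (t - δ) (t-ε<t-δ t δ<ε) (<-trans (t-δ<t t 0<δ) (t<t+δ t 0<ε))

  𝒢ℝ⊆Closure : 𝒢ℝ ⊆ Closure 𝒢ℝ
  𝒢ℝ⊆Closure t∈𝒢 U _ t∈U = _ , t∈U , t∈𝒢

  0≤2 : 0# ≤ 2#
  0≤2 = proj₁ 0<2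

  0∈∂𝒢ℝ : ∀ {t} → t ≈ 0# → t ∈ ∂ 𝒢ℝ
  0∈∂𝒢ℝ {t} t≈0 = 𝒢ℝ⊆Closure (≤-reflexive (sym t≈0) , ≤-respˡ-≈ (sym t≈0) 0≤2) , λ (U , U-open , U⊆𝒢 , t∈U) →
    let δ , 0<δ , _ , _ , t-δ∈U = open-both-sides U-open t∈U in
    <⇒≱ (t-δ<t t 0<δ) (≤-respˡ-≈ (sym t≈0) (proj₁ (U⊆𝒢 t-δ∈U)))

  2∈∂𝒢ℝ : ∀ {t} → t ≈ 2# → t ∈ ∂ 𝒢ℝ
  2∈∂𝒢ℝ {t} t≈2 = 𝒢ℝ⊆Closure (≤-respʳ-≈ (sym t≈2) 0≤2 , ≤-reflexive t≈2) , λ (U , U-open , U⊆𝒢 , t∈U) →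
    let δ , 0<δ , _ , t+δ∈U , _ = open-both-sides U-open t∈U in
    <⇒≱ (t<t+δ t 0<δ) (≤-respʳ-≈ (sym t≈2) (proj₂ (U⊆𝒢 t+δ∈U)))

  OpenInterval : ℝ → ℝ → Pred ℝ 0ℓ
  OpenInterval u v t = u < t × t < v

  OpenInterval-open : ∀ u v → OpenInℝ (OpenInterval u v)
  -- The radius is the smaller of the distances from t to the two ends.
  OpenInterval-open u v {t} (u<t , t<v) with total (t - u) (v - t)
  ... | inj₁ t-u≤v-t = t - u , x<y⇒0<y-x u<t , λ s t-ε<s s<t+ε →
    <-combine (x<y⇒0<y-x t-ε<s) (solve 3 (λ s t u → s :- (t :- (t :- u)) := s :- u) refl s t u) ,
    <-≤-trans s<t+ε (≤-combine (x≤y⇒0≤y-x t-u≤v-t) (solve 3 (λ t u v → v :- t :- (t :- u) := v :- (t :+ (t :- u))) refl t u v))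
  ... | inj₂ v-t≤t-u = v - t , x<y⇒0<y-x t<v , λ s t-ε<s s<t+ε →
    <-combine (<-≤-trans (x<y⇒0<y-x t-ε<s) (≤-+ʳ _ (x≤y⇒0≤y-x v-t≤t-u)))
      (solve 4 (λ s t u v → s :- (t :- (v :- t)) :+ (t :- u :- (v :- t)) := s :- u) refl s t u v) ,
    <-combine (x<y⇒0<y-x s<t+ε) (solve 3 (λ s t v → t :+ (v :- t) :- s := v :- s) refl s t v)

  ]0,2[⊆Interior : OpenInterval 0# 2# ⊆ Interior 𝒢ℝ
  ]0,2[⊆Interior t∈ = OpenInterval 0# 2# , OpenInterval-open 0# 2# , (λ (0<s , s<2) → proj₁ 0<s , proj₁ s<2) , t∈

  Interior⊆𝒢ℝ : Interior 𝒢ℝ ⊆ 𝒢ℝ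
  Interior⊆𝒢ℝ (U , _ , U⊆𝒢 , t∈U) = U⊆𝒢 t∈U

  -- A small step towards the midpoint 1, or to either side of it, stays in `U` and lands strictly
  -- between 0 and 2.
  𝒢ℝ⊆Closure-Interior : 𝒢ℝ ⊆ Closure (Interior 𝒢ℝ)
  𝒢ℝ⊆Closure-Interior {t} (0≤t , t≤2) U U-open t∈U = [ moved-right , moved-left ]′ (total t 1#)
    where
    nearby = open-both-sides U-open t∈U
    δ = proj₁ nearby
    0<δ : 0# < δ
    0<δ = proj₁ (proj₂ nearby)
    δ<1 : δ < 1#
    δ<1 = proj₁ (proj₂ (proj₂ nearby))
    moved-right : t ≤ 1# → Satisfiable (U ∩ Interior 𝒢ℝ)
    moved-right t≤1 = t + δ , proj₁ (proj₂ (proj₂ (proj₂ nearby))) , ]0,2[⊆Interior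
      ( <-combine (<-≤-trans 0<δ (≤-+ʳ δ 0≤t)) (solve 2 (λ t d → d :+ t := t :+ d :- con (+ 0)) refl t δ)
      , <-combine (<-≤-trans (x<y⇒0<y-x δ<1) (≤-+ʳ _ (x≤y⇒0≤y-x t≤1)))
          (solve 2 (λ t d → con (+ 1) :- d :+ (con (+ 1) :- t) := con (+ 2) :- (t :+ d)) refl t δ))
    moved-left : 1# ≤ t → Satisfiable (U ∩ Interior 𝒢ℝ)
    moved-left 1≤t = t - δ , proj₂ (proj₂ (proj₂ (proj₂ nearby))) , ]0,2[⊆Interior
      ( <-combine (<-≤-trans (x<y⇒0<y-x δ<1) (≤-+ʳ _ (x≤y⇒0≤y-x 1≤t)))
          (solve 2 (λ t d → con (+ 1) :- d :+ (t :- con (+ 1)) := t :- d :- con (+ 0)) refl t δ)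
      , <-≤-trans (t-δ<t t 0<δ) t≤2)

  -- A point outside [0,2] has an open interval around it beyond the nearer endpoint, and that
  -- interval misses `𝒢ℝ`.
  Closure-Interior⊆𝒢ℝ : Closure (Interior 𝒢ℝ) ⊆ 𝒢ℝ
  Closure-Interior⊆𝒢ℝ {t} t∈Cl = ≮⇒≥ t≮0 , ≮⇒≥ 2≮t
    where
    t≮0 : ¬ (t < 0#)
    t≮0 t<0 =
      let s , (_ , s<0) , s∈Int = t∈Cl (OpenInterval (t - 1#) 0#) (OpenInterval-open _ _) (t-δ<t t 0<1 , t<0)
      in <⇒≱ s<0 (proj₁ (Interior⊆𝒢ℝ s∈Int))
    2≮t : ¬ (2# < t)
    2≮t 2<t =
      let s , (2<s , _) , s∈Int = t∈Cl (OpenInterval 2# (t + 1#)) (OpenInterval-open _ _) (2<t , t<t+δ t 0<1)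
      in <⇒≱ 2<s (proj₂ (Interior⊆𝒢ℝ s∈Int))

  -- Definitionally the family that is local to `±Unipotent2ℤ`, repeated so that it can be named.
  U : ℤ → Matℝ.Mat 2
  U n = Matℝ.mat₂ 1# (2# * fromℤ n) 0# 1#

  _≈±U_ : Matℝ.Mat 2 → ℤ → Set
  A ≈±U n = (A Matℝ.≈ᴹ U n) ⊎ (A Matℝ.≈ᴹ Matℝ.-ᴹ U n)

  -- By contraposition, elements that differ modulo ± I have different translation lengths.
  ≈±U-unique : ∀ {A B n} → A ≈±U n → B ≈±U n → (A Matℝ.≈ᴹ B) ⊎ (A Matℝ.≈ᴹ Matℝ.-ᴹ B)
  ≈±U-unique (inj₁ p) (inj₁ q) = inj₁ λ i j → trans (p i j) (sym (q i j))
  ≈±U-unique (inj₁ p) (inj₂ q) = inj₂ λ i j → trans (p i j) (trans (sym (-‿involutive _)) (-‿cong (sym (q i j))))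
  ≈±U-unique (inj₂ p) (inj₁ q) = inj₂ λ i j → trans (p i j) (-‿cong (sym (q i j)))
  ≈±U-unique (inj₂ p) (inj₂ q) = inj₁ λ i j → trans (p i j) (sym (q i j))

  -- Matrix and action share one integer: the matrix part recovers the element up to sign, the
  -- action part locates its translate of [0,2].
  Translates : Δ → ℤ → Set
  Translates (γ , _) n = (SL₂ℝ.mat γ ≈±U n) × (∀ z → x (γ • z) ≈ x z + 2# * fromℤ n)

  stabilizer-translates : ∀ σ → ∃[ n ] Translates σ n
  stabilizer-translates (γ , γ∈H) = from-±Unipotent2ℤ (proj₁ heightStabilizer {γ} γ∈H)
    where
    from-±Unipotent2ℤ : γ ∈ ±Unipotent2ℤ → ∃[ n ] Translates (γ , γ∈H) n
    from-±Unipotent2ℤ γ∈U@(n , γ≈±U) = n , γ≈±U , translation-x (±Unipotent2ℤ⇒IsTranslation {γ} γ∈U)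

  translates-⋆ : ∀ {σ n} → Translates σ n → ∀ t → σ ⋆ t ≈ t + 2# * fromℤ n
  translates-⋆ (_ , x•≈) t = x•≈ (t +i 1# ⟨ 0<1 ⟩)

  ⋆-isInducedByx : ⋆-IsInducedByx
  ⋆-isInducedByx σ z = induced (stabilizer-translates σ)
    where
    induced : ∃[ n ] Translates σ n → x (proj₁ σ • z) ≈ σ ⋆ x z
    induced (n , T@(_ , x•≈)) = trans (x•≈ z) (sym (translates-⋆ {σ} {n} T (x z)))

  module _ (n : ℤ) where
    private
      γ : SL₂ℝ
      γ = record
        { mat   = Matℝ.mat₂ 1# (2# * fromℤ n) 0# 1#
        ; det≈1 = solve 1 (λ t → con (+ 1) :* con (+ 1) :+ :- (t :* con (+ 0)) := con (+ 1)) refl (2# * fromℤ n)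
        }

      γ∈±Unipotent2ℤ : γ ∈ ±Unipotent2ℤ
      γ∈±Unipotent2ℤ = n , inj₁ λ i j → refl

    translation : Δ
    translation = γ , proj₂ heightStabilizer {γ} γ∈±Unipotent2ℤ

    translation-⋆ : ∀ t → translation ⋆ t ≈ t + 2# * fromℤ n
    translation-⋆ t = translation-x (±Unipotent2ℤ⇒IsTranslation {γ} γ∈±Unipotent2ℤ) (t +i 1# ⟨ 0<1 ⟩)

  t∈translation⋆𝒢ℝ : ∀ {t n} → t - 2# * fromℤ n ∈ 𝒢ℝ → t ∈ Image (translation n ⋆_) 𝒢ℝ
  t∈translation⋆𝒢ℝ {t} {n} a∈𝒢 = t - 2# * fromℤ n , a∈𝒢 ,
    trans (solve 2 (λ t s → t := t :- s :+ s) refl t (2# * fromℤ n)) (sym (translation-⋆ n (t - 2# * fromℤ n)))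

  covering : ∀ t → ∃[ σ ] t ∈ Image (σ ⋆_) 𝒢ℝ
  -- For n the floor of t/2, the point t - 2n lies in [0,2].
  covering t = let n , n≤½t , ½t≤n+1 = floor (t * ½) in translation n , t∈translation⋆𝒢ℝ {t} {n}
    ( ≤-combine (*-nonneg 0≤2 (x≤y⇒0≤y-x n≤½t)) (≈-combine 2*½≈1 t (solve 3 (λ t h n →
        con (+ 2) :* (t :* h :- n) :- (t :- con (+ 2) :* n :- con (+ 0)) := t :* (con (+ 2) :* h :- con (+ 1))) refl t ½ (fromℤ n)))
    , ≤-combine (*-nonneg 0≤2 (x≤y⇒0≤y-x ½t≤n+1)) (≈-combine 2*½≈1 (- t) (solve 3 (λ t h n →
        con (+ 2) :* (n :+ con (+ 1) :- t :* h) :- (con (+ 2) :- (t :- con (+ 2) :* n)) := :- t :* (con (+ 2) :* h :- con (+ 1))) refl t ½ (fromℤ n))))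

  -- Two points of [0,2] differ by at most 2, and a difference of at least 2 is attained only by the
  -- ends.
  endpoints : ∀ {a b k} → a ∈ 𝒢ℝ → b ∈ 𝒢ℝ → a - b ≈ 2# * k → 1# ≤ k → a ≈ 2# × b ≈ 0#
  endpoints {a} {b} {k} (0≤a , a≤2) (0≤b , b≤2) a-b≈2k 1≤k =
    antisym a≤2 (≤-combine (+-nonneg 0≤a-b-2 0≤b) (solve 2 (λ a b → a :- b :- con (+ 2) :+ b := a :- con (+ 2)) refl a b)) ,
    antisym (≤-combine (+-nonneg 0≤a-b-2 (x≤y⇒0≤y-x a≤2)) (solve 2 (λ a b → a :- b :- con (+ 2) :+ (con (+ 2) :- a) := con (+ 0) :- b) refl a b)) 0≤b
    where
    0≤a-b-2 : 0# ≤ a - b - 2#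
    0≤a-b-2 = ≤-respʳ-≈ (trans (solve 1 (λ k → con (+ 2) :* (k :- con (+ 1)) := con (+ 2) :* k :- con (+ 2)) refl k)
      (+-congʳ (sym a-b≈2k))) (*-nonneg 0≤2 (x≤y⇒0≤y-x 1≤k))

  -- a - b = 2(n - m) is at least 2 in absolute value, so a and b are opposite endpoints; the sign
  -- of n - m tells which is which.
  overlap-of-translates : ∀ {a b m n} → a ∈ 𝒢ℝ → b ∈ 𝒢ℝ → ¬ (m ≡ n) →
    a + 2# * fromℤ m ≈ b + 2# * fromℤ n → a ∈ ∂ 𝒢ℝ × b ∈ ∂ 𝒢ℝ
  overlap-of-translates {a} {b} {m} {n} a∈𝒢 b∈𝒢 m≢n a+2m≈b+2n with fromℤ-discrete (n ℤ.- m)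
  ... | inj₁ n-m≡0 = ⊥-elim (m≢n (≡.sym (ℤ.i-j≡0⇒i≡j n m n-m≡0)))
  ... | inj₂ (inj₁ 1≤n-m) = let a≈2 , b≈0 = endpoints a∈𝒢 b∈𝒢 a-b≈ 1≤n-m in 2∈∂𝒢ℝ a≈2 , 0∈∂𝒢ℝ b≈0
    where
    a-b≈ : a - b ≈ 2# * fromℤ (n ℤ.- m)
    a-b≈ = trans (≈-combine a+2m≈b+2n 1# (solve 4 (λ a b m n →
        a :- b :- con (+ 2) :* (n :- m) := con (+ 1) :* (a :+ con (+ 2) :* m :- (b :+ con (+ 2) :* n)))
      refl a b (fromℤ m) (fromℤ n))) (*-congˡ (sym (fromℤ-sub n m)))
  ... | inj₂ (inj₂ n-m≤-1) = let b≈2 , a≈0 = endpoints b∈𝒢 a∈𝒢 b-a≈ 1≤m-n in 0∈∂𝒢ℝ a≈0 , 2∈∂𝒢ℝ b≈2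
    where
    b-a≈ : b - a ≈ 2# * (fromℤ m - fromℤ n)
    b-a≈ = ≈-combine a+2m≈b+2n (- 1#) (solve 4 (λ a b m n →
        b :- a :- con (+ 2) :* (m :- n) := :- con (+ 1) :* (a :+ con (+ 2) :* m :- (b :+ con (+ 2) :* n)))
      refl a b (fromℤ m) (fromℤ n))
    1≤m-n : 1# ≤ fromℤ m - fromℤ n
    1≤m-n = ≤-combine (x≤y⇒0≤y-x (≤-respˡ-≈ (fromℤ-sub n m) n-m≤-1))
      (solve 2 (λ m n → :- con (+ 1) :- (n :- m) := m :- n :- con (+ 1)) refl (fromℤ m) (fromℤ n))

  overlap⊆boundary : ∀ σ τ → ¬ (σ ≈± τ) →
    (Image (σ ⋆_) 𝒢ℝ ∩ Image (τ ⋆_) 𝒢ℝ) ⊆ (Image (σ ⋆_) (∂ 𝒢ℝ) ∩ Image (τ ⋆_) (∂ 𝒢ℝ))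
  overlap⊆boundary σ τ σ≉τ {t} ((a , a∈𝒢 , t≈σa) , (b , b∈𝒢 , t≈τb)) =
    from-translations (stabilizer-translates σ) (stabilizer-translates τ)
    where
    from-translations : ∃[ m ] Translates σ m → ∃[ n ] Translates τ n → t ∈ (Image (σ ⋆_) (∂ 𝒢ℝ) ∩ Image (τ ⋆_) (∂ 𝒢ℝ))
    from-translations (m , S) (n , T) =
      (a , proj₁ ab∈∂ , t≈σa) , (b , proj₂ ab∈∂ , t≈τb)
      where
      m≢n : ¬ (m ≡ n)
      m≢n ≡.refl = σ≉τ (≈±U-unique {SL₂ℝ.mat (proj₁ σ)} {SL₂ℝ.mat (proj₁ τ)} {m} (proj₁ S) (proj₁ T))
      ab∈∂ : a ∈ ∂ 𝒢ℝ × b ∈ ∂ 𝒢ℝ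
      ab∈∂ = overlap-of-translates {a} {b} {m} {n} a∈𝒢 b∈𝒢 m≢n (begin
        a + 2# * fromℤ m   ≈⟨ translates-⋆ {σ} {m} S a ⟨
        σ ⋆ a              ≈⟨ t≈σa ⟨
        t                  ≈⟨ t≈τb ⟩
        τ ⋆ b              ≈⟨ translates-⋆ {τ} {n} T b ⟩
        b + 2# * fromℤ n   ∎)
        where open SetoidReasoning setoid

  fundamentalDomain : IsFundamentalDomain _≈±_ _⋆_ 𝒢ℝ
  fundamentalDomain = covering , overlap⊆boundary

  𝒢ℝ≐Closure-Interior : 𝒢ℝ ≐ Closure (Interior 𝒢ℝ)
  𝒢ℝ≐Closure-Interior = 𝒢ℝ⊆Closure-Interior , Closure-Interior⊆𝒢ℝ

-- The region as a geodesic convex hull.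

module Hull (em : ExcludedMiddle 0ℓ) (R : CompleteOrderedField) where
  open CompleteOrderedField R
  open UpperHalfPlane R
  open OrderedField em R
  open Group em R using (1≤2)

  Region : Pred ℍ̄² 0ℓ
  Region = CircleRegion ∪∞

  -- On a vertical line |z - 1|² grows with the height, so the region is closed upwards. A real
  -- point has position 0, strictly below `y z`.
  upward : ∀ m p w → p ∈ Region → p on vertical m → w on vertical m →
           position (vertical m) p ≤⁺ position (vertical m) w → w ∈ Region
  upward m (inner z) (inner w) (0≤x , x≤2 , 2≤) xz≈m xw≈m [ yz≤yw ] =
    ≤-respʳ-≈ xz≈xw 0≤x , ≤-respˡ-≈ xz≈xw x≤2 , ≤-combine
      (+-nonneg (x≤y⇒0≤y-x 2≤) (*-nonneg (x≤y⇒0≤y-x yz≤yw) (+-nonneg (proj₁ (y>0 w)) (proj₁ (y>0 z)))))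
      (trans (+-congʳ (+-congʳ (+-congˡ (*-cong (+-congʳ xz≈xw) (+-congʳ xz≈xw)))))
        (solve 3 (λ x u v → u :* u :+ (x :- con (+ 1)) :* (x :- con (+ 1)) :- con (+ 2) :+ (v :- u) :* (v :+ u) :=
          v :* v :+ (x :- con (+ 1)) :* (x :- con (+ 1)) :- con (+ 2)) refl (x w) (y z) (y w)))
    where
    xz≈xw : x z ≈ x w
    xz≈xw = trans xz≈m (sym xw≈m)
  upward m (inner z) (real t)  _ _ _ [ yz≤0 ] = ⊥-elim (<⇒≱ (y>0 z) yz≤0)
  upward m (inner z) ∞         _ _ _ _        = tt
  upward m ∞         ∞         _ _ _ _        = tt

  -- On the circle |z − m| = r the defining function of the region is affine in x.
  on-semicircle : ∀ {m r 0<r} z → inner z on semicircle m r 0<r →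
    (2# * m - 2#) * x z + (r * r - m * m - 1#) ≈ y z * y z + (x z - 1#) * (x z - 1#) - 2#
  on-semicircle {m} {r} z z-on = ≈-combine z-on (- 1#) (solve 4 (λ m r x y →
    (con (+ 2) :* m :- con (+ 2)) :* x :+ (r :* r :- m :* m :- con (+ 1)) :-
      (y :* y :+ (x :- con (+ 1)) :* (x :- con (+ 1)) :- con (+ 2)) :=
    :- con (+ 1) :* ((x :- m) :* (x :- m) :+ y :* y :- r :* r)) refl m r (x z) (y z))

  between : ∀ m r 0<r p q w → p ∈ Region → q ∈ Region →
            let L = semicircle m r 0<r in p on L → q on L → w on L →
            position L p ≤⁺ position L w → position L w ≤⁺ position L q → w ∈ Region
  between m r 0<r (inner p) (inner q) (inner w) (0≤xp , _ , 2≤p) (_ , xq≤2 , 2≤q) p-on q-on w-on [ p≤w ] [ w≤q ] =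
    ≤-trans 0≤xp p≤w , ≤-trans w≤q xq≤2 , 0≤y-x⇒x≤y (≤-respʳ-≈ (on-semicircle {m} {r} {0<r} w w-on)
      (affine≥0-between _ _ p≤w w≤q (at p p-on 2≤p) (at q q-on 2≤q)))
    where
    at : ∀ z → inner z on semicircle m r 0<r → 2# ≤ y z * y z + (x z - 1#) * (x z - 1#) →
         0# ≤ (2# * m - 2#) * x z + (r * r - m * m - 1#)
    at z z-on 2≤z = ≤-respʳ-≈ (sym (on-semicircle {m} {r} {0<r} z z-on)) (x≤y⇒0≤y-x 2≤z)
  -- Points of ℍ² on the semicircle have (x - m)² < r², hence so does everything between them,
  -- whereas a real point on it has (t - m)² = r².
  between m r 0<r (inner p) (inner q) (real t) _ _ p-on q-on t-on [ p≤t ] [ t≤q ] =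
    proj₂ (square-between (shift p≤t) (shift t≤q) (inside p p-on) (inside q q-on)) t-on
    where
    shift : ∀ {u v} → u ≤ v → u - m ≤ v - m
    shift {u} {v} u≤v = ≤-combine (x≤y⇒0≤y-x u≤v) (solve 3 (λ u v m → v :- u := v :- m :- (u :- m)) refl u v m)
    inside : ∀ z → inner z on semicircle m r 0<r → (x z - m) * (x z - m) < r * r
    inside z z-on = <-combine (*-pos (y>0 z) (y>0 z)) (≈-combine z-on 1# (solve 3 (λ u y r →
      y :* y :- (r :* r :- u :* u) := con (+ 1) :* (u :* u :+ y :* y :- r :* r)) refl (x z - m) (y z) r))

  region-convex : Convex Region
  region-convex p∈ q∈ {w} (vertical m , p-on , _ , w-on , inj₁ (p≤w , _)) = upward m _ w p∈ p-on w-on p≤w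
  region-convex p∈ q∈ {w} (vertical m , _ , q-on , w-on , inj₂ (q≤w , _)) = upward m _ w q∈ q-on w-on q≤w
  region-convex p∈ q∈ {w} (semicircle m r 0<r , p-on , q-on , w-on , inj₁ (p≤w , w≤q)) =
    between m r 0<r _ _ w p∈ q∈ p-on q-on w-on p≤w w≤q
  region-convex p∈ q∈ {w} (semicircle m r 0<r , p-on , q-on , w-on , inj₂ (q≤w , w≤p)) =
    between m r 0<r _ _ w q∈ p∈ q-on p-on w-on q≤w w≤p

  vertices : Vector ℍ̄² 3
  vertices = inner 𝐢 ∷ inner 2+𝐢 ∷ ∞ ∷ []

  vertices∈Region : ∀ k → vertices k ∈ Region
  vertices∈Region 0F = ≤-refl , proj₁ 0<2 , ≤-reflexive
    (solve 0 (con (+ 2) := con (+ 1) :* con (+ 1) :+ (con (+ 0) :- con (+ 1)) :* (con (+ 0) :- con (+ 1))) refl)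
  vertices∈Region 1F = proj₁ 0<2 , ≤-refl , ≤-reflexive
    (solve 0 (con (+ 2) := con (+ 1) :* con (+ 1) :+ (con (+ 2) :- con (+ 1)) :* (con (+ 2) :- con (+ 1))) refl)
  vertices∈Region 2F = tt

  hull⊆Region : 𝒞ᴴ vertices ⊆ Region
  hull⊆Region w∈𝒞 = w∈𝒞 Region region-convex vertices∈Region

  Region⊆hull : Region ⊆ 𝒞ᴴ vertices
  Region⊆hull {∞}       _                 S S-convex v∈S = v∈S 2F
  Region⊆hull {inner z} (0≤x , x≤2 , 2≤) S S-convex v∈S =
    S-convex foot∈S (v∈S 2F) (vertical (x z) , refl , tt , refl , inj₁ ([ foot-below ] , (_ ≤⊤⁺)))
    where
    √2 : ℝ
    √2 = proj₁ (sqrt 1≤2)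
    √2²≈2 : √2 * √2 ≈ 2#
    √2²≈2 = proj₂ (proj₂ (sqrt 1≤2))
    -- The height of the arc above x; the radicand is 1 + x(2 - x), at least 1 on [0,2], as `sqrt`
    -- requires.
    h : ∃[ h ] 1# ≤ h × h * h ≈ 2# - (x z - 1#) * (x z - 1#)
    h = sqrt (≤-combine (*-nonneg 0≤x (x≤y⇒0≤y-x x≤2)) (solve 1 (λ x →
      x :* (con (+ 2) :- x) := con (+ 2) :- (x :- con (+ 1)) :* (x :- con (+ 1)) :- con (+ 1)) refl (x z)))
    h²≈ = proj₂ (proj₂ h)
    foot : ℍ²
    foot = x z +i proj₁ h ⟨ <-≤-trans 0<1 (proj₁ (proj₂ h)) ⟩
    arc : Geodesic
    arc = semicircle 1# √2 (<-≤-trans 0<1 (proj₁ (proj₂ (sqrt 1≤2))))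
    foot∈S : inner foot ∈ S
    foot∈S = S-convex (v∈S 0F) (v∈S 1F) (arc ,
      trans (solve 0 ((con (+ 0) :- con (+ 1)) :* (con (+ 0) :- con (+ 1)) :+ con (+ 1) :* con (+ 1) := con (+ 2)) refl) (sym √2²≈2) ,
      trans (solve 0 ((con (+ 2) :- con (+ 1)) :* (con (+ 2) :- con (+ 1)) :+ con (+ 1) :* con (+ 1) := con (+ 2)) refl) (sym √2²≈2) ,
      trans (trans (+-congˡ h²≈) (solve 1 (λ u → u :+ (con (+ 2) :- u) := con (+ 2)) refl _)) (sym √2²≈2) ,
      inj₁ ([ 0≤x ] , [ x≤2 ]))
    foot-below : y foot ≤ y z
    -- With h the height of the foot, (y + h)(y - h) = |z - 1|² - 2 ≥ 0.
    foot-below = 0≤y-x⇒x≤y (*-cancelˡ-nonneg {y z + y foot} (<-≤-trans (y>0 z) (≤-+ʳ _ (proj₁ (y>0 foot))))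
      (≤-respʳ-≈ (≈-combine h²≈ 1# (solve 3 (λ h x y →
          y :* y :+ (x :- con (+ 1)) :* (x :- con (+ 1)) :- con (+ 2) :- (y :+ h) :* (y :- h) :=
          con (+ 1) :* (h :* h :- (con (+ 2) :- (x :- con (+ 1)) :* (x :- con (+ 1))))) refl (y foot) (x z) (y z)))
        (x≤y⇒0≤y-x 2≤)))

  region≐hull : CircleRegion ∪∞ ≐ 𝒞ᴴ (inner 𝐢 ∷ inner 2+𝐢 ∷ ∞ ∷ [])
  region≐hull = (λ {w} → Region⊆hull {w}) , λ {w} → hull⊆Region {w}

lemma1p3p2p9 : ExcludedMiddle 0ℓ →
    (R : CompleteOrderedField) →
    let open UpperHalfPlane R in
    (HeightStabilizer ≐ ±Unipotent2ℤ)
    × (⋆-IsInducedByx × IsFundamentalDomain _≈±_ _⋆_ 𝒢ℝ × (𝒢ℝ ≐ Closure (Interior 𝒢ℝ)))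
    × (ℱℝ 𝒢ℝ ≐ CircleRegion)
    × (CircleRegion ∪∞ ≐ 𝒞ᴴ (inner 𝐢 ∷ inner 2+𝐢 ∷ ∞ ∷ []))
lemma1p3p2p9 em R =
  heightStabilizer ,
  (⋆-isInducedByx , fundamentalDomain , 𝒢ℝ≐Closure-Interior) ,
  ℱℝ≐CircleRegion ,
  region≐hull
  where
  open Action em R
  open FundamentalInterval em R
  open Hull em R
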